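{- Let $A$ be a positive semidefinite matrix, $\|x\|=\sqrt{x^\top Ax}$, and let $\Phi=f+h$, where $f$ is a convex differentiable function that is $1$-smooth and $\mu$-strongly-convex with respect to $\|\cdot\|$ and $h$ is a lower semicontinuous proper convex function. Let $x^*$ be a minimizer of $\Phi$. Let $x^{(0)}$ be a starting point, put $y^{(0)}=z^{(0)}=x^{(0)}$, and for $k=0,1,\dots,T-1$ let $$\alpha_{k+1}=\frac{k+2}{2},\qquad \tau_k=\frac1{\alpha_{k+1}}=\frac{2}{k+2},\qquad x^{(k+1)}=(1-\tau_k)y^{(k)}+\tau_kz^{(k)},$$ let $y^{(k+1)}$ be any point that minimizes $\bar\Phi_{x^{(k+1)}}$ up to additive error $\varepsilon_{k+1}$, i.e. $\bar\Phi_{x^{(k+1)}}(y^{(k+1)})-\min_y\bar\Phi_{x^{(k+1)}}(y)\le\varepsilon_{k+1}$, and let $$z^{(k+1)}=z^{(k)}+\alpha_{k+1}\bigl(y^{(k+1)}-x^{(k+1)}\bigr).$$ Then for any $T>1$, $$\Phi(y^{(T)})-\Phi(x^*)\le\frac{2}{(T+1)^2}\left(\|x^{(0)}-x^*\|+3\sum_{k=1}^{T}k\sqrt{2\varepsilon_k}\right)^2 .$$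
   Context: "Norm" here means seminorm (nonzero vectors may have norm $0$). A convex differentiable $f$ is $L$-smooth w.r.t. $\|\cdot\|$ if $f(y)\le f(x)+\nabla f(x)^\top(y-x)+\frac L2\|y-x\|^2$ for all $x,y$ in its domain, and $\mu$-strongly-convex if $f(y)\ge f(x)+\nabla f(x)^\top(y-x)+\frac\mu2\|y-x\|^2$ for all $x,y$ in its domain. For any $x$, $\bar f_x(u)=f(x)+\nabla f(x)^\top(u-x)+\frac12\|u-x\|^2$ is the quadratic approximation of the $1$-smooth function $f$ around $x$, and $\bar\Phi_x(y)=\bar f_x(y)+h(y)$. A minimizer of $\bar\Phi_x$ is called a proximal mapping of $x$ and is taken to exist. -}

module Defs where

open import Algebra.Structures using (IsCommutativeRing)
open import Data.Nat.Base as ℕ using (ℕ; zero; suc)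
open import Data.Product.Base using (∃; _×_; _,_; proj₁)
open import Data.Sum.Base using (_⊎_; inj₁; inj₂; [_,_]′)
open import Data.Vec.Base using (Vec; map; zipWith; foldr′; transpose)
open import Function.Base using (const)
open import Relation.Binary.PropositionalEquality.Core
  using (_≡_; _≢_; refl; subst)
open import Relation.Binary.Structures using (IsDecTotalOrder)
open import Relation.Nullary.Construct.Add.Extrema using (_±; ⊥±; [_]; ⊤±)
import Relation.Binary.Construct.Add.Extrema.NonStrict as NonStrict
import Relation.Binary.Construct.Add.Extrema.Strict as Strict
import Relation.Binary.Construct.NonStrictToStrict as ToStrict

-- The real numbers, given by their usual classical axioms: a totally ordered
-- field in which nonempty bounded sets have suprema.  Classically such a field
-- exists and is unique up to isomorphism.

record CompleteOrderedField : Set₁ where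
  infix  9 _⁻¹ _²
  infix  8 -_
  infixl 7 _*_ _/_
  infixl 6 _+_ _-_
  infix  4 _≤_

  field
    ℝ       : Set
    _+_ _*_ : ℝ → ℝ → ℝ
    -_      : ℝ → ℝ
    0# 1#   : ℝ
    _⁻¹     : ℝ → ℝ   -- total, but its value at 0# is unspecified
    _≤_     : ℝ → ℝ → Set

    isCommutativeRing : IsCommutativeRing _≡_ _+_ _*_ -_ 0# 1#
    *-inverseʳ        : ∀ {x} → x ≢ 0# → x * x ⁻¹ ≡ 1#
    isDecTotalOrder   : IsDecTotalOrder _≡_ _≤_
    0≤1               : 0# ≤ 1#
    0≢1               : 0# ≢ 1#
    +-monoˡ-≤         : ∀ z {x y} → x ≤ y → x + z ≤ y + z
    *-monoˡ-≤-nonNeg  : ∀ {z} → 0# ≤ z → ∀ {x y} → x ≤ y → x * z ≤ y * z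

  UpperBound : (ℝ → Set) → ℝ → Set
  UpperBound S b = ∀ x → S x → x ≤ b

  field
    supremum : ∀ (S : ℝ → Set) → ∃ S → ∃ (UpperBound S) →
               ∃ λ s → UpperBound S s × (∀ b → UpperBound S b → s ≤ b)

  open IsCommutativeRing isCommutativeRing using (*-identityˡ)
  open IsDecTotalOrder isDecTotalOrder using (total)
    renaming (refl to ≤-refl; trans to ≤-trans)
  open ToStrict _≡_ _≤_ public using (_<_)

  _-_ _/_ : ℝ → ℝ → ℝ
  x - y = x + - y
  x / y = x * y ⁻¹

  _² : ℝ → ℝ
  x ² = x * x

  ∣_∣ : ℝ → ℝ
  ∣ x ∣ = [ const x , const (- x) ]′ (total 0# x)

  ι : ℕ → ℝ
  ι zero    = 0#
  ι (suc k) = ι k + 1#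

  ½ : ℝ
  ½ = 1# / ι 2

  ∑[1⋯_] : ℕ → (ℕ → ℝ) → ℝ
  ∑[1⋯ zero  ] a = 0#
  ∑[1⋯ suc m ] a = ∑[1⋯ m ] a + a (suc m)

  -- √ a is the largest y with y ² ≤ a; including 0# makes √ total, with
  -- √ a ≡ 0# for negative a.

  SquareBelow : ℝ → ℝ → Set
  SquareBelow a y = y ≡ 0# ⊎ y ² ≤ a

  squareBelow-bounded : ∀ a → ∃ (UpperBound (SquareBelow a))
  squareBelow-bounded a =
    [ (λ 1≤a → a  , bound ≤-refl 1≤a)
    , (λ a≤1 → 1# , bound a≤1 ≤-refl)
    ]′ (total 1# a)
    where
    bound : ∀ {b} → a ≤ b → 1# ≤ b → UpperBound (SquareBelow a) b
    bound a≤b 1≤b y (inj₁ refl) = ≤-trans 0≤1 1≤b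
    bound a≤b 1≤b y (inj₂ y²≤a) with total y 1#
    ... | inj₁ y≤1 = ≤-trans y≤1 1≤b
    ... | inj₂ 1≤y = ≤-trans y≤y² (≤-trans y²≤a a≤b)
      where
      y≤y² : y ≤ y ²
      y≤y² = subst (_≤ y ²) (*-identityˡ y) (*-monoˡ-≤-nonNeg (≤-trans 0≤1 1≤y) 1≤y)

  √ : ℝ → ℝ
  √ a = proj₁ (supremum (SquareBelow a) (0# , inj₁ refl) (squareBelow-bounded a))

module ConvexOptimization (𝓡 : CompleteOrderedField) where
  open CompleteOrderedField 𝓡 public

  infixl 7 _·_ _*ᵥ_ _*ₘ_
  infixl 6 _+ᵥ_ _-ᵥ_ _+±_ _-±_

  ℝ^ : ℕ → Set
  ℝ^ n = Vec ℝ n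

  Matrix : ℕ → Set
  Matrix n = Vec (Vec ℝ n) n

  private variable n : ℕ

  _+ᵥ_ _-ᵥ_ : ℝ^ n → ℝ^ n → ℝ^ n
  _+ᵥ_ = zipWith _+_
  _-ᵥ_ = zipWith _-_

  _*ᵥ_ : ℝ → ℝ^ n → ℝ^ n
  c *ᵥ x = map (c *_) x

  _·_ : ℝ^ n → ℝ^ n → ℝ
  x · y = foldr′ _+_ 0# (zipWith _*_ x y)

  _*ₘ_ : Matrix n → ℝ^ n → ℝ^ n
  A *ₘ x = map (_· x) A

  PositiveSemidefinite : Matrix n → Set
  PositiveSemidefinite A = transpose A ≡ A × (∀ x → 0# ≤ x · (A *ₘ x))

  ‖_‖[_] : ℝ^ n → Matrix n → ℝ
  ‖ x ‖[ A ] = √ (x · (A *ₘ x))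

  ‖_‖₂ : ℝ^ n → ℝ
  ‖ x ‖₂ = √ (x · x)

  -- Extended reals: ⊥± is −∞ and ⊤± is +∞.

  open NonStrict _≤_ public using (_≤±_)
  open Strict _<_ public using (_<±_)

  -- Addition with the convention (+∞) + (−∞) = +∞, so that a difference
  -- bounded above by a real is never an artefact of an undefined ∞ − ∞.

  _+±_ : ℝ ± → ℝ ± → ℝ ±
  ⊤±    +± _     = ⊤±
  ⊥±    +± ⊤±    = ⊤±
  [ _ ] +± ⊤±    = ⊤±
  ⊥±    +± ⊥±    = ⊥±
  ⊥±    +± [ _ ] = ⊥±
  [ _ ] +± ⊥±    = ⊥±
  [ a ] +± [ b ] = [ a + b ]

  -±_ : ℝ ± → ℝ ±
  -± ⊤±    = ⊥±
  -± ⊥±    = ⊤±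
  -± [ a ] = [ - a ]

  _-±_ : ℝ ± → ℝ ± → ℝ ±
  a -± b = a +± (-± b)

  Convex : (ℝ^ n → ℝ) → Set
  Convex f = ∀ x y t → 0# ≤ t → t ≤ 1# →
    f ((1# - t) *ᵥ x +ᵥ t *ᵥ y) ≤ (1# - t) * f x + t * f y

  -- Fréchet differentiability everywhere, with gradient g.

  IsGradient : (ℝ^ n → ℝ) → (ℝ^ n → ℝ^ n) → Set
  IsGradient f g = ∀ x e → 0# < e → ∃ λ d → 0# < d × (∀ v → ‖ v ‖₂ < d →
    ∣ f (x +ᵥ v) - f x - g x · v ∣ ≤ e * ‖ v ‖₂)

  Smooth : (ℝ^ n → ℝ) → ℝ → (ℝ^ n → ℝ) → (ℝ^ n → ℝ^ n) → Set
  Smooth ‖_‖ L f ∇f = ∀ x y →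
    f y ≤ f x + ∇f x · (y -ᵥ x) + L / ι 2 * ‖ y -ᵥ x ‖ ²

  StronglyConvex : (ℝ^ n → ℝ) → ℝ → (ℝ^ n → ℝ) → (ℝ^ n → ℝ^ n) → Set
  StronglyConvex ‖_‖ μ f ∇f = ∀ x y →
    f x + ∇f x · (y -ᵥ x) + μ / ι 2 * ‖ y -ᵥ x ‖ ² ≤ f y

  Proper : (ℝ^ n → ℝ ±) → Set
  Proper h = (∀ x → h x ≢ ⊥±) × ∃ λ x → h x ≢ ⊤±

  -- Convexity of the epigraph { (x , a) | h x ≤ a }, which for real-valued
  -- functions is Convex and avoids products such as 0 · ∞.

  Convex± : (ℝ^ n → ℝ ±) → Set
  Convex± h = ∀ x y a b t → 0# ≤ t → t ≤ 1# → h x ≤± [ a ] → h y ≤± [ b ] →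
    h ((1# - t) *ᵥ x +ᵥ t *ᵥ y) ≤± [ (1# - t) * a + t * b ]

  LowerSemicontinuous : (ℝ^ n → ℝ ±) → Set
  LowerSemicontinuous h = ∀ x c → [ c ] <± h x →
    ∃ λ d → 0# < d × (∀ u → ‖ u -ᵥ x ‖₂ < d → [ c ] <± h u)

  IsMinimizer : (ℝ^ n → ℝ ±) → ℝ^ n → Set
  IsMinimizer F p = ∀ u → F p ≤± F u

  HasMinimizer : (ℝ^ n → ℝ ±) → Set
  HasMinimizer F = ∃ (IsMinimizer F)

  minimum : (F : ℝ^ n → ℝ ±) → HasMinimizer F → ℝ ±
  minimum F (p , _) = F p

  composite : (ℝ^ n → ℝ) → (ℝ^ n → ℝ ±) → ℝ^ n → ℝ ±
  composite f h x = [ f x ] +± h x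

  -- quadraticModel A f ∇f x is the function f̄ₓ.

  quadraticModel : Matrix n → (ℝ^ n → ℝ) → (ℝ^ n → ℝ^ n) → ℝ^ n → ℝ^ n → ℝ
  quadraticModel A f ∇f x u = f x + ∇f x · (u -ᵥ x) + ½ * ‖ u -ᵥ x ‖[ A ] ²

  -- α₊₁ k is αₖ₊₁ and τ k is τₖ.

  α₊₁ τ : ℕ → ℝ
  α₊₁ k = ι (k ℕ.+ 2) / ι 2
  τ   k = 1# / α₊₁ k

  -- Φ̄ is x ↦ Φ̄ₓ, and prox-exists provides the minimum of each Φ̄ₓ.

  record AcceleratedRun (Φ̄ : ℝ^ n → ℝ^ n → ℝ ±)
                        (prox-exists : ∀ x → HasMinimizer (Φ̄ x))
                        (T : ℕ) (ε : ℕ → ℝ) (x y z : ℕ → ℝ^ n) : Set where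
    field
      y-init : y 0 ≡ x 0
      z-init : z 0 ≡ x 0
      x-step : ∀ k → k ℕ.< T →
        x (suc k) ≡ (1# - τ k) *ᵥ y k +ᵥ τ k *ᵥ z k
      y-step : ∀ k → k ℕ.< T →
        Φ̄ (x (suc k)) (y (suc k)) -± minimum (Φ̄ (x (suc k))) (prox-exists (x (suc k)))
          ≤± [ ε (suc k) ]
      z-step : ∀ k → k ℕ.< T →
        z (suc k) ≡ z k +ᵥ α₊₁ k *ᵥ (y (suc k) -ᵥ x (suc k))

{-# OPTIONS --safe #-}
module Submission where

open import Defs
open import Data.Nat.Base using (ℕ; suc; zero)
import Data.Nat.Base as ℕ
open import Relation.Nullary.Construct.Add.Extrema using (_±; [_])

open import Algebra.Bundles using (CommutativeRing)
import Algebra.Properties.Group as GroupProperties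
import Algebra.Properties.Ring as RingProperties
import Algebra.Solver.Ring as RingSolver
open import Algebra.Solver.Ring.AlmostCommutativeRing
  using (fromCommutativeRing; _-Raw-AlmostCommutative⟶_)
open import Data.Empty using (⊥-elim)
open import Data.Integer.Base as ℤ using (ℤ; -[1+_]; +0; +[1+_])
import Data.Integer.Properties as ℤ
open import Data.Maybe.Base using (just; nothing)
import Data.Nat.Properties as ℕ
open import Data.Product.Base using (∃; _×_; _,_; proj₁; proj₂)
import Data.Sign.Base as Sign
open import Data.Sum.Base using (inj₁; inj₂; [_,_]′)
open import Data.Vec.Base using (Vec; []; _∷_; map)
open import Function.Base using (_∘_)
open import Relation.Binary.Definitions using (WeaklyDecidable)
open import Relation.Binary.PropositionalEquality
  using (_≡_; _≢_; refl; sym; trans; cong; cong₂; subst; subst₂; module ≡-Reasoning)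
open import Relation.Binary.Structures using (IsDecTotalOrder)
open import Relation.Nullary using (¬_; yes; no)
open import Relation.Nullary.Construct.Add.Extrema using (⊥±; ⊤±)
import Relation.Binary.Construct.Add.Extrema.NonStrict as NonStrict
import Relation.Binary.Construct.Add.Supremum.NonStrict as Supremum

-- One step compares y⁽ᵏ⁺¹⁾ with the combination u = (1 − τₖ) y⁽ᵏ⁾ + τₖ x*, through
-- the exact proximal point p.  Strong convexity of Φ̄ at p gives both
-- ‖y⁽ᵏ⁺¹⁾ − p‖² ≤ 2εₖ₊₁ and a decrease of Φ in terms of ‖u − x⁽ᵏ⁺¹⁾‖² − ‖u − p‖².
-- Since u − x⁽ᵏ⁺¹⁾ = τₖ (x* − z⁽ᵏ⁾) and u − y⁽ᵏ⁺¹⁾ = τₖ (x* − z⁽ᵏ⁺¹⁾),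
-- Cauchy–Schwarz turns it into
--
--   Eₖ₊₁ ≤ Eₖ + 2 aₖ₊₁ Rₖ₊₁ + aₖ₊₁²,   aₖ = k √(2εₖ),   Rₖ = ‖z⁽ᵏ⁾ − x*‖,
--
-- for the energy Eₖ = ½ (k+1)² (Φ(y⁽ᵏ⁾) − Φ(x*)) + Rₖ² (with the first term dropped
-- when k = 0).  As Rₖ² ≤ Eₖ, the bound Eₖ ≤ Bₖ² propagates with Bₖ₊₁ = Bₖ + 3 aₖ₊₁.
-- The inequalities are written with denominators cleared, that is for 4 Eₖ.

-- A ring solver over the reals with integer coefficients.

module FieldProperties (𝓡 : CompleteOrderedField) where
  open CompleteOrderedField 𝓡

  commutativeRing : CommutativeRing _ _
  commutativeRing = record { isCommutativeRing = isCommutativeRing }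

  open CommutativeRing commutativeRing using
    ( +-assoc; +-comm; +-identityˡ; +-identityʳ; -‿inverseʳ
    ; *-identityˡ; *-identityʳ; *-assoc; *-comm; zeroˡ; zeroʳ; distribʳ; ring; +-group) public
  open RingProperties ring using (-‿distribˡ-*; -‿distribʳ-*; -‿+-comm; -0#≈0#)
  open GroupProperties +-group using () renaming (⁻¹-involutive to -‿involutive)

  ι-+ : ∀ m n → ι (m ℕ.+ n) ≡ ι m + ι n
  ι-+ zero    n = sym (+-identityˡ (ι n))
  ι-+ (suc m) n = begin
    ι (m ℕ.+ n) + 1#    ≡⟨ cong (_+ 1#) (ι-+ m n) ⟩
    ι m + ι n + 1#      ≡⟨ +-assoc (ι m) (ι n) 1# ⟩
    ι m + (ι n + 1#)    ≡⟨ cong (ι m +_) (+-comm (ι n) 1#) ⟩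
    ι m + (1# + ι n)    ≡⟨ +-assoc (ι m) 1# (ι n) ⟨
    ι m + 1# + ι n      ∎
    where open ≡-Reasoning

  ι-* : ∀ m n → ι (m ℕ.* n) ≡ ι m * ι n
  ι-* zero    n = sym (zeroˡ (ι n))
  ι-* (suc m) n = begin
    ι (n ℕ.+ m ℕ.* n)    ≡⟨ ι-+ n (m ℕ.* n) ⟩
    ι n + ι (m ℕ.* n)    ≡⟨ cong (ι n +_) (ι-* m n) ⟩
    ι n + ι m * ι n      ≡⟨ +-comm (ι n) (ι m * ι n) ⟩
    ι m * ι n + ι n      ≡⟨ cong (ι m * ι n +_) (*-identityˡ (ι n)) ⟨
    ι m * ι n + 1# * ι n ≡⟨ distribʳ (ι n) (ι m) 1# ⟨
    (ι m + 1#) * ι n     ∎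
    where open ≡-Reasoning

  -- 1 is sent to 1# itself rather than to ι 1, so that the constants 0#, 1# and
  -- ι n of a goal are all of the form ⟦ i ⟧.
  ⟦_⟧⁺ : ℕ → ℝ
  ⟦ 1 ⟧⁺ = 1#
  ⟦ n ⟧⁺ = ι n

  ⟦_⟧ : ℤ → ℝ
  ⟦ ℤ.+ n      ⟧ = ⟦ n ⟧⁺
  ⟦ -[1+ n ] ⟧ = - ⟦ suc n ⟧⁺

  ⟦⟧⁺≡ι : ∀ n → ⟦ n ⟧⁺ ≡ ι n
  ⟦⟧⁺≡ι 0             = refl
  ⟦⟧⁺≡ι 1             = sym (+-identityˡ 1#)
  ⟦⟧⁺≡ι (suc (suc n)) = refl

  ⟦-⟧ : ∀ i → ⟦ ℤ.- i ⟧ ≡ - ⟦ i ⟧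
  ⟦-⟧ +0         = sym -0#≈0#
  ⟦-⟧ +[1+ n ]   = refl
  ⟦-⟧ (-[1+ n ]) = sym (-‿involutive _)

  -- The right side is in `ι`, which unfolds uniformly at `suc`, whereas `⟦_⟧⁺` has a special case
  -- at 1. The induction cancels one `1#` on each side.
  ⟦⊖⟧ : ∀ m n → ⟦ m ℤ.⊖ n ⟧ ≡ ι m - ι n
  ⟦⊖⟧ m       zero    = trans (⟦⟧⁺≡ι m) (sym (trans (cong (ι m +_) -0#≈0#) (+-identityʳ (ι m))))
  ⟦⊖⟧ zero    (suc n) = trans (cong -_ (⟦⟧⁺≡ι (suc n))) (sym (+-identityˡ _))
  ⟦⊖⟧ (suc m) (suc n) = begin
    ⟦ suc m ℤ.⊖ suc n ⟧      ≡⟨ cong ⟦_⟧ (ℤ.[1+m]⊖[1+n]≡m⊖n m n) ⟩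
    ⟦ m ℤ.⊖ n ⟧              ≡⟨ ⟦⊖⟧ m n ⟩
    ι m - ι n                ≡⟨ cong (_- ι n) (+-identityʳ (ι m)) ⟨
    ι m + 0# - ι n           ≡⟨ cong (λ z → ι m + z - ι n) (-‿inverseʳ 1#) ⟨
    ι m + (1# - 1#) - ι n    ≡⟨ cong (_- ι n) (+-assoc (ι m) 1# (- 1#)) ⟨
    ι m + 1# - 1# - ι n      ≡⟨ +-assoc (ι m + 1#) (- 1#) (- ι n) ⟩
    ι m + 1# + (- 1# - ι n)  ≡⟨ cong (ι m + 1# +_) (+-comm (- 1#) (- ι n)) ⟩
    ι m + 1# + (- ι n - 1#)  ≡⟨ cong (ι m + 1# +_) (-‿+-comm (ι n) 1#) ⟩
    ι m + 1# - (ι n + 1#)    ∎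
    where open ≡-Reasoning

  ⟦+⟧⁺ : ∀ m n → ⟦ m ℕ.+ n ⟧⁺ ≡ ⟦ m ⟧⁺ + ⟦ n ⟧⁺
  ⟦+⟧⁺ m n = begin
    ⟦ m ℕ.+ n ⟧⁺     ≡⟨ ⟦⟧⁺≡ι (m ℕ.+ n) ⟩
    ι (m ℕ.+ n)      ≡⟨ ι-+ m n ⟩
    ι m + ι n        ≡⟨ cong₂ _+_ (⟦⟧⁺≡ι m) (⟦⟧⁺≡ι n) ⟨
    ⟦ m ⟧⁺ + ⟦ n ⟧⁺  ∎
    where open ≡-Reasoning

  ⟦*⟧⁺ : ∀ m n → ⟦ m ℕ.* n ⟧⁺ ≡ ⟦ m ⟧⁺ * ⟦ n ⟧⁺
  ⟦*⟧⁺ m n = begin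
    ⟦ m ℕ.* n ⟧⁺     ≡⟨ ⟦⟧⁺≡ι (m ℕ.* n) ⟩
    ι (m ℕ.* n)      ≡⟨ ι-* m n ⟩
    ι m * ι n        ≡⟨ cong₂ _*_ (⟦⟧⁺≡ι m) (⟦⟧⁺≡ι n) ⟨
    ⟦ m ⟧⁺ * ⟦ n ⟧⁺  ∎
    where open ≡-Reasoning

  ⟦⊖⟧⁺ : ∀ m n → ⟦ m ℤ.⊖ n ⟧ ≡ ⟦ m ⟧⁺ - ⟦ n ⟧⁺
  ⟦⊖⟧⁺ m n = trans (⟦⊖⟧ m n) (sym (cong₂ _-_ (⟦⟧⁺≡ι m) (⟦⟧⁺≡ι n)))

  ⟦+⟧ : ∀ i j → ⟦ i ℤ.+ j ⟧ ≡ ⟦ i ⟧ + ⟦ j ⟧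
  ⟦+⟧ (ℤ.+ m)    (ℤ.+ n)    = ⟦+⟧⁺ m n
  ⟦+⟧ (ℤ.+ m)    -[1+ n ] = ⟦⊖⟧⁺ m (suc n)
  ⟦+⟧ -[1+ m ] (ℤ.+ n)    = trans (⟦⊖⟧⁺ n (suc m)) (+-comm _ _)
  ⟦+⟧ -[1+ m ] -[1+ n ] = begin
    - ⟦ suc (suc (m ℕ.+ n)) ⟧⁺         ≡⟨ cong (-_ ∘ ⟦_⟧⁺ ∘ suc) (ℕ.+-suc m n) ⟨
    - ⟦ suc m ℕ.+ suc n ⟧⁺             ≡⟨ cong -_ (⟦+⟧⁺ (suc m) (suc n)) ⟩
    - (⟦ suc m ⟧⁺ + ⟦ suc n ⟧⁺)        ≡⟨ -‿+-comm _ _ ⟨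
    - ⟦ suc m ⟧⁺ - ⟦ suc n ⟧⁺          ∎
    where open ≡-Reasoning

  ⟦*⟧ : ∀ i j → ⟦ i ℤ.* j ⟧ ≡ ⟦ i ⟧ * ⟦ j ⟧
  ⟦*⟧ (ℤ.+ m)    (ℤ.+ n)    = trans (cong ⟦_⟧ (ℤ.+◃n≡+n (m ℕ.* n))) (⟦*⟧⁺ m n)
  ⟦*⟧ (ℤ.+ m)    -[1+ n ] = begin
    ⟦ Sign.- ℤ.◃ m ℕ.* suc n ⟧   ≡⟨ cong ⟦_⟧ (ℤ.-◃n≡-n (m ℕ.* suc n)) ⟩
    ⟦ ℤ.- (ℤ.+ (m ℕ.* suc n)) ⟧    ≡⟨ ⟦-⟧ (ℤ.+ (m ℕ.* suc n)) ⟩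
    - ⟦ m ℕ.* suc n ⟧⁺           ≡⟨ cong -_ (⟦*⟧⁺ m (suc n)) ⟩
    - (⟦ m ⟧⁺ * ⟦ suc n ⟧⁺)      ≡⟨ -‿distribʳ-* _ _ ⟩
    ⟦ m ⟧⁺ * - ⟦ suc n ⟧⁺        ∎
    where open ≡-Reasoning
  ⟦*⟧ -[1+ m ] (ℤ.+ n)    = begin
    ⟦ Sign.- ℤ.◃ suc m ℕ.* n ⟧   ≡⟨ cong ⟦_⟧ (ℤ.-◃n≡-n (suc m ℕ.* n)) ⟩
    ⟦ ℤ.- (ℤ.+ (suc m ℕ.* n)) ⟧    ≡⟨ ⟦-⟧ (ℤ.+ (suc m ℕ.* n)) ⟩
    - ⟦ suc m ℕ.* n ⟧⁺           ≡⟨ cong -_ (⟦*⟧⁺ (suc m) n) ⟩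
    - (⟦ suc m ⟧⁺ * ⟦ n ⟧⁺)      ≡⟨ -‿distribˡ-* _ _ ⟩
    - ⟦ suc m ⟧⁺ * ⟦ n ⟧⁺        ∎
    where open ≡-Reasoning
  ⟦*⟧ -[1+ m ] -[1+ n ] = begin
    ⟦ suc m ℕ.* suc n ⟧⁺             ≡⟨ ⟦*⟧⁺ (suc m) (suc n) ⟩
    ⟦ suc m ⟧⁺ * ⟦ suc n ⟧⁺          ≡⟨ -‿involutive _ ⟨
    - - (⟦ suc m ⟧⁺ * ⟦ suc n ⟧⁺)    ≡⟨ cong -_ (-‿distribˡ-* _ _) ⟩
    - (- ⟦ suc m ⟧⁺ * ⟦ suc n ⟧⁺)    ≡⟨ -‿distribʳ-* _ _ ⟩
    - ⟦ suc m ⟧⁺ * - ⟦ suc n ⟧⁺      ∎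
    where open ≡-Reasoning

  -- Equality of integers is decided by computation, which abstract reals do not offer, so with
  -- these coefficients the normaliser can collect and cancel numerals.
  ℤ-coefficients : ℤ.+-*-rawRing -Raw-AlmostCommutative⟶ fromCommutativeRing commutativeRing
  ℤ-coefficients = record
    { ⟦_⟧ = ⟦_⟧ ; +-homo = ⟦+⟧ ; *-homo = ⟦*⟧ ; -‿homo = ⟦-⟧
    ; 0-homo = refl ; 1-homo = refl }

  _coeff≟_ : WeaklyDecidable (λ i j → ⟦ i ⟧ ≡ ⟦ j ⟧)
  i coeff≟ j with i ℤ.≟ j
  ... | yes i≡j = just (cong ⟦_⟧ i≡j)
  ... | no  _   = nothing

  open RingSolver ℤ.+-*-rawRing (fromCommutativeRing commutativeRing)
    ℤ-coefficients _coeff≟_ public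
    using (solve; con; _:=_; _:+_; _:*_; _:-_; :-_)


  -- Order, division and limits in the ordered field.

  open IsDecTotalOrder isDecTotalOrder public using (total; antisym; _≤?_)
    renaming (refl to ≤-refl; trans to ≤-trans; reflexive to ≤-reflexive)

  private variable
    a b c d e : ℝ

  ≰⇒≥ : ¬ a ≤ b → b ≤ a
  ≰⇒≥ {a} {b} a≰b = [ ⊥-elim ∘ a≰b , (λ b≤a → b≤a) ]′ (total a b)

  +-mono-≤ : a ≤ b → c ≤ d → a + c ≤ b + d
  +-mono-≤ {a} {b} {c} {d} a≤b c≤d = ≤-trans (+-monoˡ-≤ c a≤b)
    (subst₂ _≤_ (+-comm c b) (+-comm d b) (+-monoˡ-≤ b c≤d))

  infixl 6 _+≥0_
  infixl 7 _*≥0_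

  _+≥0_ : 0# ≤ a → 0# ≤ b → 0# ≤ a + b
  0≤a +≥0 0≤b = subst (_≤ _) (+-identityˡ 0#) (+-mono-≤ 0≤a 0≤b)

  _*≥0_ : 0# ≤ a → 0# ≤ b → 0# ≤ a * b
  _*≥0_ {b = b} 0≤a 0≤b = subst (_≤ _) (zeroˡ b) (*-monoˡ-≤-nonNeg 0≤b 0≤a)

  ≤⇒0≤- : a ≤ b → 0# ≤ b - a
  ≤⇒0≤- {a} a≤b = subst (_≤ _) (-‿inverseʳ a) (+-monoˡ-≤ (- a) a≤b)

  0≤-⇒≤ : 0# ≤ b - a → a ≤ b
  0≤-⇒≤ {b} {a} 0≤b-a = subst₂ _≤_ (+-identityˡ a)
    (solve 2 (λ a b → b :- a :+ a := b) refl a b) (+-monoˡ-≤ a 0≤b-a)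

  -- The shape of most inequality proofs below: `e` is a certificate assembled from visibly
  -- nonnegative terms, and the identity is left to the ring solver.
  ≤-by : 0# ≤ e → b - a ≡ e → a ≤ b
  ≤-by 0≤e b-a≡e = 0≤-⇒≤ (subst (0# ≤_) (sym b-a≡e) 0≤e)

  0≤² : ∀ a → 0# ≤ a ²
  0≤² a with total 0# a
  ... | inj₁ 0≤a = 0≤a *≥0 0≤a
  ... | inj₂ a≤0 = subst (0# ≤_) (solve 1 (λ a → (con +0 :- a) :* (con +0 :- a) := a :* a) refl a)
                     (≤⇒0≤- a≤0 *≥0 ≤⇒0≤- a≤0)

  -- In the case b ≤ a, multiplying by c reverses the hypothesis, so it is an equality, and the
  -- inverse of c gives a = b.
  *-cancelˡ-≤ : 0# < c → c * a ≤ c * b → a ≤ b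
  *-cancelˡ-≤ {c = t} {a = a} {b = b} (0≤t , 0≢t) ta≤tb with total a b
  ... | inj₁ a≤b = a≤b
  ... | inj₂ b≤a = ≤-reflexive (begin
    a              ≡⟨ divide a ⟨
    t ⁻¹ * (t * a) ≡⟨ cong (t ⁻¹ *_) (antisym ta≤tb tb≤ta) ⟩
    t ⁻¹ * (t * b) ≡⟨ divide b ⟩
    b              ∎)
    where
    open ≡-Reasoning
    divide : ∀ x → t ⁻¹ * (t * x) ≡ x
    divide x = begin
      t ⁻¹ * (t * x) ≡⟨ *-assoc (t ⁻¹) t x ⟨
      t ⁻¹ * t * x   ≡⟨ cong (_* x) (trans (*-comm (t ⁻¹) t) (*-inverseʳ (0≢t ∘ sym))) ⟩
      1# * x         ≡⟨ *-identityˡ x ⟩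
      x              ∎
    tb≤ta : t * b ≤ t * a
    tb≤ta = subst₂ _≤_ (*-comm b t) (*-comm a t) (*-monoˡ-≤-nonNeg 0≤t b≤a)

  *-cancelˡ-≤0 : 0# < c → c * a ≤ 0# → a ≤ 0#
  *-cancelˡ-≤0 {c = t} 0<t ta≤0 = *-cancelˡ-≤ 0<t (subst (_ ≤_) (sym (zeroʳ t)) ta≤0)

  0≤⁻¹ : 0# < a → 0# ≤ a ⁻¹
  0≤⁻¹ {a} 0<t = *-cancelˡ-≤ 0<t (subst₂ _≤_ (sym (zeroʳ a))
    (sym (*-inverseʳ (proj₂ 0<t ∘ sym))) 0≤1)

  /-* : 0# < b → a / b * b ≡ a
  /-* {b} {a} 0<b = begin
    a * b ⁻¹ * b    ≡⟨ *-assoc a (b ⁻¹) b ⟩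
    a * (b ⁻¹ * b)  ≡⟨ cong (a *_) (*-comm (b ⁻¹) b) ⟩
    a * (b * b ⁻¹)  ≡⟨ cong (a *_) (*-inverseʳ (proj₂ 0<b ∘ sym)) ⟩
    a * 1#          ≡⟨ *-identityʳ a ⟩
    a               ∎
    where open ≡-Reasoning

  0</ : 0# < a → 0# < b → 0# < a / b
  0</ {a} {b} (0≤a , 0≢a) 0<b = 0≤a *≥0 0≤⁻¹ 0<b ,
    λ 0≡a/b → 0≢a (trans (sym (zeroˡ b)) (trans (cong (_* b) 0≡a/b) (/-* 0<b)))

  ²≤0⇒≤0 : 0# ≤ a → a ² ≤ 0# → a ≤ 0#
  ²≤0⇒≤0 {a} 0≤a a²≤0 with a ≤? 0#
  ... | yes a≤0 = a≤0
  ... | no  a≰0 = *-cancelˡ-≤0 (0≤a , a≰0 ∘ ≤-reflexive ∘ sym) a²≤0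

  -- If b ≤ a, then -(a - b)² = (b² - a²) + 2b(a - b) is nonnegative, which forces a - b ≤ 0.
  ²-cancel-≤ : 0# ≤ b → a ² ≤ b ² → a ≤ b
  ²-cancel-≤ {b} {a} 0≤b a²≤b² with total a b
  ... | inj₁ a≤b = a≤b
  ... | inj₂ b≤a = ≤-by (≤⇒0≤- (²≤0⇒≤0 (≤⇒0≤- b≤a)
    (≤-by (≤⇒0≤- a²≤b² +≥0 0≤b *≥0 ≤⇒0≤- b≤a +≥0 0≤b *≥0 ≤⇒0≤- b≤a)
      (solve 2 (λ a b → con +0 :- (a :- b) :* (a :- b)
                := (b :* b :- a :* a) :+ b :* (a :- b) :+ b :* (a :- b)) refl a b))))
    (solve 2 (λ a b → b :- a := con +0 :- (a :- b)) refl a b)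

  0≤ι : ∀ n → 0# ≤ ι n
  0≤ι zero    = ≤-refl
  0≤ι (suc n) = 0≤ι n +≥0 0≤1

  1≤ι : ∀ n → 1# ≤ ι (suc n)
  1≤ι n = ≤-by (0≤ι n) (solve 1 (λ k → k :+ con (ℤ.+ 1) :- con (ℤ.+ 1) := k) refl (ι n))

  1≤⇒0< : 1# ≤ a → 0# < a
  1≤⇒0< 1≤a = ≤-trans 0≤1 1≤a , λ 0≡a → 0≢1 (antisym 0≤1 (subst (1# ≤_) (sym 0≡a) 1≤a))

  0<ι : ∀ n → 0# < ι (suc n)
  0<ι n = 1≤⇒0< (1≤ι n)

  ½*2≡1 : ½ * ι 2 ≡ 1#
  ½*2≡1 = /-* (0<ι 1)

  2*[+½*] : ∀ a b → ι 2 * (a + ½ * b) ≡ ι 2 * a + b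
  2*[+½*] a b = begin
    ι 2 * (a + ½ * b)        ≡⟨ solve 3 (λ a b k → con (ℤ.+ 2) :* (a :+ k :* b)
                                  := con (ℤ.+ 2) :* a :+ k :* con (ℤ.+ 2) :* b) refl a b ½ ⟩
    ι 2 * a + ½ * ι 2 * b    ≡⟨ cong (λ k → ι 2 * a + k * b) ½*2≡1 ⟩
    ι 2 * a + 1# * b         ≡⟨ cong (ι 2 * a +_) (*-identityˡ b) ⟩
    ι 2 * a + b              ∎
    where open ≡-Reasoning

  2*-mono-≤ : a ≤ b → ι 2 * a ≤ ι 2 * b
  2*-mono-≤ {a} {b} a≤b = ≤-by (0≤ι 2 *≥0 ≤⇒0≤- a≤b)
    (solve 2 (λ a b → con (ℤ.+ 2) :* b :- con (ℤ.+ 2) :* a := con (ℤ.+ 2) :* (b :- a)) refl a b)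

  -- If d = a − b were positive, t = d / (d + c) would contradict the hypothesis.
  ≤-limit : (∀ t → 0# < t → t ≤ 1# → a ≤ b + t * c) → a ≤ b
  ≤-limit {a} {b} {c} h with a ≤? b | total 0# c
  ... | yes a≤b | _        = a≤b
  ... | no  _   | inj₂ c≤0 = ≤-by
    (≤⇒0≤- (h 1# (1≤⇒0< ≤-refl) ≤-refl) +≥0 ≤⇒0≤- c≤0)
    (solve 3 (λ a b c → b :- a := (b :+ con (ℤ.+ 1) :* c :- a) :+ (con +0 :- c)) refl a b c)
  ... | no  a≰b | inj₁ 0≤c = ⊥-elim (d≰0 (²≤0⇒≤0 0≤d d²≤0))
    where
    0≤d : 0# ≤ a - b
    0≤d = ≤⇒0≤- (≰⇒≥ a≰b)

    d≰0 : ¬ a - b ≤ 0#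
    d≰0 d≤0 = a≰b (≤-by (≤⇒0≤- d≤0) (solve 2 (λ a b → b :- a := con +0 :- (a :- b)) refl a b))

    s t : ℝ
    s = a - b + c
    t = (a - b) / s

    0<s : 0# < s
    0<s = 0≤d +≥0 0≤c , λ 0≡s → d≰0 (≤-by 0≤c (trans
      (solve 2 (λ d c → con +0 :- d := c :- (d :+ c)) refl (a - b) c)
      (trans (cong (λ x → c - x) (sym 0≡s)) (solve 1 (λ c → c :- con +0 := c) refl c))))

    ts≡d : t * s ≡ a - b
    ts≡d = /-* 0<s

    0<t : 0# < t
    0<t = 0</ (0≤d , d≰0 ∘ ≤-reflexive ∘ sym) 0<s

    t≤1 : t ≤ 1#
    t≤1 = *-cancelˡ-≤ 0<s (≤-by 0≤c (trans
      (cong (λ x → s * 1# - x) (trans (*-comm s t) ts≡d))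
      (solve 2 (λ d c → (d :+ c) :* con (ℤ.+ 1) :- d := c) refl (a - b) c)))

    d²≤0 : (a - b) ² ≤ 0#
    d²≤0 = ≤-by (proj₁ 0<s *≥0 ≤⇒0≤- (h t 0<t t≤1)) (begin
      0# - (a - b) ²                       ≡⟨ solve 3 (λ a b c → con +0 :- (a :- b) :* (a :- b)
                                                := (a :- b) :* c :- (a :- b :+ c) :* (a :- b)) refl a b c ⟩
      (a - b) * c - s * (a - b)            ≡⟨ cong (λ x → x * c - s * (a - b)) (sym ts≡d) ⟩
      t * s * c - s * (a - b)              ≡⟨ solve 5 (λ a b c s t → t :* s :* c :- s :* (a :- b)
                                                := s :* (b :+ t :* c :- a)) refl a b c s t ⟩
      s * (b + t * c - a)                  ∎)
      where open ≡-Reasoning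

  -- The form in which convexity on short segments yields a first-order inequality: divide by t,
  -- then let t tend to 0.
  *-≤-limit : (∀ t → 0# < t → t ≤ 1# → t * a ≤ t * (b + t * c)) → a ≤ b
  *-≤-limit h = ≤-limit λ t 0<t t≤1 → *-cancelˡ-≤ 0<t (h t 0<t t≤1)

  -- Square roots as suprema.

  0≤√ : ∀ a → 0# ≤ √ a
  0≤√ a = proj₁ (proj₂ (supremum (SquareBelow a) _ (squareBelow-bounded a))) 0# (inj₁ refl)

  √-upperBound : ∀ a → UpperBound (SquareBelow a) (√ a)
  √-upperBound a = proj₁ (proj₂ (supremum (SquareBelow a) _ (squareBelow-bounded a)))

  √-least : ∀ a b → UpperBound (SquareBelow a) b → √ a ≤ b
  √-least a = proj₂ (proj₂ (supremum (SquareBelow a) _ (squareBelow-bounded a)))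

  -- For 0 < t ≤ 1 the square of (1 - t) √a is at most a, since otherwise (1 - t) √a would bound the
  -- set whose supremum is √a. The claim follows as t tends to 0.
  √²≤ : 0# ≤ a → √ a ² ≤ a
  √²≤ {a} 0≤a = ≤-limit λ t 0<t t≤1 → ≤-by
    (≤⇒0≤- (shrunk t 0<t t≤1) +≥0 0≤² (t * √ a))
    (solve 3 (λ a s t → a :+ t :* (con (ℤ.+ 2) :* (s :* s)) :- s :* s
       := (a :- (con (ℤ.+ 1) :- t) :* s :* ((con (ℤ.+ 1) :- t) :* s)) :+ t :* s :* (t :* s))
     refl a (√ a) t)
    where
    shrunk : ∀ t → 0# < t → t ≤ 1# → ((1# - t) * √ a) ² ≤ a
    shrunk t 0<t t≤1 with ((1# - t) * √ a) ² ≤? a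
    ... | yes r²≤a = r²≤a
    -- An upper bound (1 - t) √a is contradictory only if √a is positive; here it forces `√ a ≡ 0#`,
    -- and then the square is `0#`, which is at most a by hypothesis.
    ... | no  r²≰a = subst (_≤ a) (begin
      0#                           ≡⟨ solve 1 (λ t → con +0 := (con (ℤ.+ 1) :- t) :* con +0
                                        :* ((con (ℤ.+ 1) :- t) :* con +0)) refl t ⟩
      ((1# - t) * 0#) ²            ≡⟨ cong (λ s → ((1# - t) * s) ²) (antisym (0≤√ a) √≤0) ⟩
      ((1# - t) * √ a) ²           ∎) 0≤a
      where
      open ≡-Reasoning

      0≤r : 0# ≤ (1# - t) * √ a
      0≤r = ≤⇒0≤- t≤1 *≥0 0≤√ a

      bound : UpperBound (SquareBelow a) ((1# - t) * √ a)
      bound y (inj₁ refl) = 0≤r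
      bound y (inj₂ y²≤a) = ²-cancel-≤ 0≤r (≤-trans y²≤a (≰⇒≥ r²≰a))

      √≤0 : √ a ≤ 0#
      √≤0 = *-cancelˡ-≤0 0<t (≤-by (≤⇒0≤- (√-least a _ bound))
        (solve 2 (λ s t → con +0 :- t :* s := (con (ℤ.+ 1) :- t) :* s :- s) refl (√ a) t))

  -- For t > 0 the number √a + t lies above the supremum, so its square is at least a; again t tends
  -- to 0.
  ≤√² : a ≤ √ a ²
  ≤√² {a} = ≤-limit λ t 0<t t≤1 → ≤-by
    (≤⇒0≤- (enlarged t 0<t) +≥0 proj₁ 0<t *≥0 ≤⇒0≤- t≤1)
    (solve 3 (λ a s t → s :* s :+ t :* (con (ℤ.+ 2) :* s :+ con (ℤ.+ 1)) :- a
       := ((s :+ t) :* (s :+ t) :- a) :+ t :* (con (ℤ.+ 1) :- t)) refl a (√ a) t)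
    where
    enlarged : ∀ t → 0# < t → a ≤ (√ a + t) ²
    enlarged t 0<t with (√ a + t) ² ≤? a
    ... | no  r²≰a = ≰⇒≥ r²≰a
    ... | yes r²≤a = ⊥-elim (proj₂ 0<t (antisym (proj₁ 0<t) (≤-by
      (≤⇒0≤- (√-upperBound a (√ a + t) (inj₂ r²≤a)))
      (solve 2 (λ s t → con +0 :- t := s :- (s :+ t)) refl (√ a) t))))

  √² : 0# ≤ a → √ a ² ≡ a
  √² 0≤a = antisym (√²≤ 0≤a) ≤√²

  0<+ : 0# ≤ a → 0# < b → 0# < a + b
  0<+ {a} {b} 0≤a (0≤b , 0≢b) = 0≤a +≥0 0≤b , λ 0≡a+b → 0≢b (antisym 0≤b (≤-by 0≤a (trans
    (solve 2 (λ a b → con +0 :- b := a :- (a :+ b)) refl a b)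
    (trans (cong (λ x → a - x) (sym 0≡a+b)) (solve 1 (λ a → a :- con +0 := a) refl a)))))

  -- Scalar inequalities behind the energy recursion.

  -- The induction step for the energy bound, with w = 4 Eₖ₊₁ and r = Rₖ₊₁. Since r occurs on both
  -- sides, r ≤ B + 3a is shown first; then B² + 2a(B + 3a) + a² = B² + 2aB + 7a² is below (B +
  -- 3a)².
  growth : ∀ {B w r} → 0# ≤ a → 0# ≤ B → ι 4 * r ² ≤ w →
    w ≤ ι 4 * B ² + ι 8 * (a * r) + ι 4 * a ² → w ≤ ι 4 * (B + ι 3 * a) ²
  growth {a} {B} {w} {r} 0≤a 0≤B 4r²≤w w≤ = ≤-by
    (≤⇒0≤- w≤ +≥0 0≤ι 8 *≥0 (0≤a *≥0 ≤⇒0≤- r≤) +≥0 0≤ι 16 *≥0 (0≤a *≥0 0≤B) +≥0 0≤ι 8 *≥0 0≤² a)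
    (solve 4 (λ a B w r →
      con (ℤ.+ 4) :* ((B :+ con (ℤ.+ 3) :* a) :* (B :+ con (ℤ.+ 3) :* a)) :- w
      := (con (ℤ.+ 4) :* (B :* B) :+ con (ℤ.+ 8) :* (a :* r) :+ con (ℤ.+ 4) :* (a :* a) :- w)
         :+ con (ℤ.+ 8) :* (a :* (B :+ con (ℤ.+ 3) :* a :- r))
         :+ con (ℤ.+ 16) :* (a :* B) :+ con (ℤ.+ 8) :* (a :* a)) refl a B w r)
    where
    r≤ : r ≤ B + ι 3 * a
    r≤ with total r (B + ι 3 * a)
    ... | inj₁ r≤ = r≤
    -- With d = r - (B + 3a) ≥ 0, the two hypotheses give 4r² ≤ 4B² + 8ar + 4a², which makes -4d² a
    -- sum of nonnegative terms.
    ... | inj₂ ≤r = ≤-by (≤⇒0≤- (²≤0⇒≤0 0≤d (*-cancelˡ-≤0 (0<ι 3) (≤-by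
      (≤⇒0≤- (≤-trans 4r²≤w w≤) +≥0 0≤ι 8 *≥0 0≤² a +≥0 0≤ι 16 *≥0 (0≤a *≥0 0≤B)
        +≥0 0≤ι 8 *≥0 (0≤B *≥0 0≤d) +≥0 0≤ι 16 *≥0 (0≤a *≥0 0≤d))
      (solve 3 (λ a B r → let d = r :- (B :+ con (ℤ.+ 3) :* a) in
        con +0 :- con (ℤ.+ 4) :* (d :* d)
        := (con (ℤ.+ 4) :* (B :* B) :+ con (ℤ.+ 8) :* (a :* r) :+ con (ℤ.+ 4) :* (a :* a)
             :- con (ℤ.+ 4) :* (r :* r))
           :+ con (ℤ.+ 8) :* (a :* a) :+ con (ℤ.+ 16) :* (a :* B)
           :+ con (ℤ.+ 8) :* (B :* d) :+ con (ℤ.+ 16) :* (a :* d)) refl a B r)))))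
      (solve 2 (λ r b → b :- r := con +0 :- (r :- b)) refl r (B + ι 3 * a))
      where
      0≤d : 0# ≤ r - (B + ι 3 * a)
      0≤d = ≤⇒0≤- ≤r

  -- Multiplying by m² clears τ because mτ = 2. In the application m = k + 2 and j = k + 1: the
  -- weight m²(1 - τ) = m² - 2m is at most j², and m ≤ 2j bounds the error terms.
  energy-rescaled : ∀ {τ m j D D′ s R Z Z′} → m * τ ≡ ι 2 → 0# ≤ m → m * m ≤ j ² + ι 2 * m →
    m ≤ ι 2 * j → 0# ≤ D → 0# ≤ s → 0# ≤ R →
    ι 2 * D′ + τ * τ * Z′ ≤ ι 2 * ((1# - τ) * D) + τ * τ * Z + ι 2 * (s * (τ * R)) + s ² →
    ι 2 * (m ² * D′) + ι 4 * Z′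
      ≤ ι 2 * (j ² * D) + ι 4 * Z + ι 8 * (j * s * R) + ι 4 * (j * s) ²
  energy-rescaled {τ} {m} {j} {D} {D′} {s} {R} {Z} {Z′} mτ≡2 0≤m m²≤ m≤2j 0≤D 0≤s 0≤R h = ≤-by
    (≤⇒0≤- scaled +≥0 0≤ι 2 *≥0 (≤⇒0≤- m²≤ *≥0 0≤D)
      +≥0 0≤ι 4 *≥0 (0≤s *≥0 0≤R *≥0 ≤⇒0≤- m≤2j)
      +≥0 0≤² s *≥0 (≤⇒0≤- m≤2j *≥0 (0≤m +≥0 ≤-trans 0≤m m≤2j)))
    (solve 8 (λ m j D D′ s R Z Z′ →
      let 2× = con (ℤ.+ 2) :*_ ; 4× = con (ℤ.+ 4) :*_ in
      2× (j :* j :* D) :+ 4× Z :+ con (ℤ.+ 8) :* (j :* s :* R) :+ 4× (j :* s :* (j :* s))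
        :- (2× (m :* m :* D′) :+ 4× Z′)
      := (2× ((m :* m :- m :* con (ℤ.+ 2)) :* D) :+ con (ℤ.+ 2) :* con (ℤ.+ 2) :* Z
            :+ 2× (m :* s :* (con (ℤ.+ 2) :* R)) :+ m :* m :* (s :* s)
          :- (2× (m :* m :* D′) :+ con (ℤ.+ 2) :* con (ℤ.+ 2) :* Z′))
         :+ 2× ((j :* j :+ 2× m :- m :* m) :* D)
         :+ 4× (s :* R :* (2× j :- m))
         :+ s :* s :* ((2× j :- m) :* (m :+ 2× j))) refl m j D D′ s R Z Z′)
    where
    -- The ring identity is checked with the product mτ kept symbolic; each occurrence of it is then
    -- replaced by `ι 2`.
    scaled : ι 2 * (m ² * D′) + ι 2 * ι 2 * Z′
      ≤ ι 2 * ((m * m - m * ι 2) * D) + ι 2 * ι 2 * Z + ι 2 * (m * s * (ι 2 * R)) + m * m * s ²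
    scaled = subst (λ e → ι 2 * (m ² * D′) + e * e * Z′
        ≤ ι 2 * ((m * m - m * e) * D) + e * e * Z + ι 2 * (m * s * (e * R)) + m * m * s ²) mτ≡2
      (≤-by (0≤² m *≥0 ≤⇒0≤- h) (solve 8 (λ t m D D′ s R Z Z′ →
        let 2× = con (ℤ.+ 2) :*_ ; e = m :* t in
        2× ((m :* m :- m :* e) :* D) :+ e :* e :* Z :+ 2× (m :* s :* (e :* R)) :+ m :* m :* (s :* s)
          :- (2× (m :* m :* D′) :+ e :* e :* Z′)
        := m :* m :* (2× ((con (ℤ.+ 1) :- t) :* D) :+ t :* t :* Z :+ 2× (s :* (t :* R)) :+ s :* s
             :- (2× D′ :+ t :* t :* Z′))) refl τ m D D′ s R Z Z′))

-- Affine combinations and the dot product, coordinatewise.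

module VectorProperties (𝓡 : CompleteOrderedField) where
  open ConvexOptimization 𝓡
  open FieldProperties 𝓡

  private variable
    m n : ℕ

  1-t+t : ∀ t (x y : ℝ^ n) → ((1# - t) *ᵥ x +ᵥ t *ᵥ y) -ᵥ x ≡ t *ᵥ (y -ᵥ x)
  1-t+t t []      []      = refl
  1-t+t t (x ∷ u) (y ∷ v) = cong₂ _∷_
    (solve 3 (λ t x y → (con (ℤ.+ 1) :- t) :* x :+ t :* y :- x := t :* (y :- x)) refl t x y)
    (1-t+t t u v)

  combination-sub : ∀ t (p u x : ℝ^ n) →
    ((1# - t) *ᵥ p +ᵥ t *ᵥ u) -ᵥ x ≡ (p -ᵥ x) +ᵥ t *ᵥ (u -ᵥ p)
  combination-sub t []      []      []      = refl
  combination-sub t (p ∷ q) (u ∷ v) (x ∷ y) = cong₂ _∷_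
    (solve 4 (λ t p u x → (con (ℤ.+ 1) :- t) :* p :+ t :* u :- x := p :- x :+ t :* (u :- p))
      refl t p u x)
    (combination-sub t q v y)

  sub-split : ∀ (p u x : ℝ^ n) → u -ᵥ x ≡ (p -ᵥ x) +ᵥ (u -ᵥ p)
  sub-split []      []      []      = refl
  sub-split (p ∷ q) (u ∷ v) (x ∷ y) = cong₂ _∷_
    (solve 3 (λ p u x → u :- x := p :- x :+ (u :- p)) refl p u x)
    (sub-split q v y)

  combination-sub-combination : ∀ t (y z w : ℝ^ n) →
    ((1# - t) *ᵥ y +ᵥ t *ᵥ w) -ᵥ ((1# - t) *ᵥ y +ᵥ t *ᵥ z) ≡ (- t) *ᵥ (z -ᵥ w)
  combination-sub-combination t []      []      []      = refl
  combination-sub-combination t (y ∷ p) (z ∷ q) (w ∷ r) = cong₂ _∷_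
    (solve 4 (λ t y z w →
       (con (ℤ.+ 1) :- t) :* y :+ t :* w :- ((con (ℤ.+ 1) :- t) :* y :+ t :* z)
       := (:- t) :* (z :- w)) refl t y z w)
    (combination-sub-combination t p q r)

  -- As ts = 1, the z-step multiplied by t is exactly y₊ - x, so subtracting it from the identity
  -- for u - x turns z into the updated point.
  combination-sub-step : ∀ {t s} → t * s ≡ 1# → ∀ (y z w y₊ : ℝ^ n) →
    ((1# - t) *ᵥ y +ᵥ t *ᵥ w) -ᵥ y₊
      ≡ (- t) *ᵥ ((z +ᵥ s *ᵥ (y₊ -ᵥ ((1# - t) *ᵥ y +ᵥ t *ᵥ z))) -ᵥ w)
  combination-sub-step ts≡1 [] [] [] [] = refl
  combination-sub-step {t = t} {s} ts≡1 (y ∷ p) (z ∷ q) (w ∷ r) (y₊ ∷ p₊) = cong₂ _∷_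
    (begin
      (1# - t) * y + t * w - y₊
        ≡⟨ solve 5 (λ t y z w y₊ → (con (ℤ.+ 1) :- t) :* y :+ t :* w :- y₊
             := (:- t) :* (z :- w) :- con (ℤ.+ 1) :* (y₊ :- ((con (ℤ.+ 1) :- t) :* y :+ t :* z)))
             refl t y z w y₊ ⟩
      (- t) * (z - w) - 1# * (y₊ - x)
        ≡⟨ cong (λ e → (- t) * (z - w) - e * (y₊ - x)) (sym ts≡1) ⟩
      (- t) * (z - w) - t * s * (y₊ - x)
        ≡⟨ solve 6 (λ t s z w y₊ x → (:- t) :* (z :- w) :- t :* s :* (y₊ :- x)
             := (:- t) :* (z :+ s :* (y₊ :- x) :- w)) refl t s z w y₊ x ⟩
      (- t) * (z + s * (y₊ - x) - w) ∎)
    (combination-sub-step ts≡1 p q r p₊)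
    where
    open ≡-Reasoning
    x : ℝ
    x = (1# - t) * y + t * z

  -- Allows a point of weight zero to be exchanged for any other, as the first iteration requires.
  0*ᵥ : ∀ (u v : ℝ^ n) → 0# *ᵥ u ≡ 0# *ᵥ v
  0*ᵥ []      []      = refl
  0*ᵥ (x ∷ u) (y ∷ v) = cong₂ _∷_ (trans (zeroˡ x) (sym (zeroˡ y))) (0*ᵥ u v)

  ·-+ʳ : ∀ (g u v : ℝ^ n) → g · (u +ᵥ v) ≡ g · u + g · v
  ·-+ʳ []      []      []      = sym (+-identityˡ 0#)
  ·-+ʳ (a ∷ g) (x ∷ u) (y ∷ v) = trans (cong (a * (x + y) +_) (·-+ʳ g u v))
    (solve 5 (λ a x y p q → a :* (x :+ y) :+ (p :+ q) := a :* x :+ p :+ (a :* y :+ q))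
      refl a x y (g · u) (g · v))

  ·-+ˡ : ∀ (u v g : ℝ^ n) → (u +ᵥ v) · g ≡ u · g + v · g
  ·-+ˡ []      []      []      = sym (+-identityˡ 0#)
  ·-+ˡ (x ∷ u) (y ∷ v) (a ∷ g) = trans (cong ((x + y) * a +_) (·-+ˡ u v g))
    (solve 5 (λ a x y p q → (x :+ y) :* a :+ (p :+ q) := x :* a :+ p :+ (y :* a :+ q))
      refl a x y (u · g) (v · g))

  ·-*ʳ : ∀ c (g u : ℝ^ n) → g · (c *ᵥ u) ≡ c * (g · u)
  ·-*ʳ c []      []      = sym (zeroʳ c)
  ·-*ʳ c (a ∷ g) (x ∷ u) = trans (cong (a * (c * x) +_) (·-*ʳ c g u))
    (solve 4 (λ c a x p → a :* (c :* x) :+ c :* p := c :* (a :* x :+ p)) refl c a x (g · u))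

  ·-*ˡ : ∀ c (u g : ℝ^ n) → (c *ᵥ u) · g ≡ c * (u · g)
  ·-*ˡ c []      []      = sym (zeroʳ c)
  ·-*ˡ c (x ∷ u) (a ∷ g) = trans (cong (c * x * a +_) (·-*ˡ c u g))
    (solve 4 (λ c a x p → c :* x :* a :+ c :* p := c :* (x :* a :+ p)) refl c a x (u · g))

  map-·-+ : ∀ (M : Vec (ℝ^ n) m) u v → map (_· (u +ᵥ v)) M ≡ map (_· u) M +ᵥ map (_· v) M
  map-·-+ []      u v = refl
  map-·-+ (g ∷ M) u v = cong₂ _∷_ (·-+ʳ g u v) (map-·-+ M u v)

  map-·-* : ∀ c (M : Vec (ℝ^ n) m) u → map (_· (c *ᵥ u)) M ≡ c *ᵥ map (_· u) M
  map-·-* c []      u = refl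
  map-·-* c (g ∷ M) u = cong₂ _∷_ (·-*ʳ c g u) (map-·-* c M u)

  -- The quadratic form of `A` and its seminorm.

  module QuadraticForm (A : Matrix n) where

    ⟪_,_⟫ : ℝ^ n → ℝ^ n → ℝ
    ⟪ u , v ⟫ = u · (A *ₘ v)

    N : ℝ^ n → ℝ
    N v = ⟪ v , v ⟫

    -- The polarization N(u + v) - N(u) - N(v); for symmetric `A` it is twice ⟪u, v⟫.
    polar : ℝ^ n → ℝ^ n → ℝ
    polar u v = ⟪ u , v ⟫ + ⟪ v , u ⟫

    ⟪⟫-+ʳ : ∀ u v w → ⟪ u , v +ᵥ w ⟫ ≡ ⟪ u , v ⟫ + ⟪ u , w ⟫
    ⟪⟫-+ʳ u v w = trans (cong (u ·_) (map-·-+ A v w)) (·-+ʳ u _ _)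

    ⟪⟫-* : ∀ c d u v → ⟪ c *ᵥ u , d *ᵥ v ⟫ ≡ c * d * ⟪ u , v ⟫
    ⟪⟫-* c d u v = begin
      (c *ᵥ u) · (A *ₘ (d *ᵥ v))  ≡⟨ ·-*ˡ c u _ ⟩
      c * (u · (A *ₘ (d *ᵥ v)))   ≡⟨ cong (λ w → c * (u · w)) (map-·-* d A v) ⟩
      c * (u · (d *ᵥ (A *ₘ v)))   ≡⟨ cong (c *_) (·-*ʳ d u _) ⟩
      c * (d * ⟪ u , v ⟫)         ≡⟨ *-assoc c d _ ⟨
      c * d * ⟪ u , v ⟫           ∎
      where open ≡-Reasoning

    N-* : ∀ c v → N (c *ᵥ v) ≡ c * c * N v
    N-* c v = ⟪⟫-* c c v v

    N-+ : ∀ u v → N (u +ᵥ v) ≡ N u + polar u v + N v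
    N-+ u v = begin
      ⟪ u +ᵥ v , u +ᵥ v ⟫                                  ≡⟨ ·-+ˡ u v _ ⟩
      ⟪ u , u +ᵥ v ⟫ + ⟪ v , u +ᵥ v ⟫                      ≡⟨ cong₂ _+_ (⟪⟫-+ʳ u u v) (⟪⟫-+ʳ v u v) ⟩
      ⟪ u , u ⟫ + ⟪ u , v ⟫ + (⟪ v , u ⟫ + ⟪ v , v ⟫)      ≡⟨ solve 4 (λ a b c d →
                                                               a :+ b :+ (c :+ d) := a :+ (b :+ c) :+ d)
                                                               refl ⟪ u , u ⟫ ⟪ u , v ⟫ ⟪ v , u ⟫ ⟪ v , v ⟫ ⟩
      ⟪ u , u ⟫ + (⟪ u , v ⟫ + ⟪ v , u ⟫) + ⟪ v , v ⟫      ∎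
      where open ≡-Reasoning

    polar-* : ∀ c d u v → polar (c *ᵥ u) (d *ᵥ v) ≡ c * d * polar u v
    polar-* c d u v = trans (cong₂ _+_ (⟪⟫-* c d u v) (⟪⟫-* d c v u))
      (solve 4 (λ c d p q → c :* d :* p :+ d :* c :* q := c :* d :* (p :+ q))
        refl c d ⟪ u , v ⟫ ⟪ v , u ⟫)

    N-combination : ∀ c d u v → N (c *ᵥ u +ᵥ d *ᵥ v) ≡ c * c * N u + c * d * polar u v + d * d * N v
    N-combination c d u v = trans (N-+ (c *ᵥ u) (d *ᵥ v))
      (cong₂ _+_ (cong₂ _+_ (N-* c u) (polar-* c d u v)) (N-* d v))

    N-+-* : ∀ t u v → N (u +ᵥ t *ᵥ v) ≡ N u + t * polar u v + t * t * N v
    N-+-* t u v = begin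
      N (u +ᵥ t *ᵥ v)                                        ≡⟨ N-+ u (t *ᵥ v) ⟩
      N u + polar u (t *ᵥ v) + N (t *ᵥ v)                    ≡⟨ cong₂ (λ p q → N u + p + q) polar≡ (N-* t v) ⟩
      N u + t * polar u v + t * t * N v                      ∎
      where
      open ≡-Reasoning
      polar≡ : polar u (t *ᵥ v) ≡ t * polar u v
      polar≡ = begin
        ⟪ u , t *ᵥ v ⟫ + ⟪ t *ᵥ v , u ⟫  ≡⟨ cong₂ _+_ (trans (cong (u ·_) (map-·-* t A v)) (·-*ʳ t u _))
                                              (·-*ˡ t v _) ⟩
        t * ⟪ u , v ⟫ + t * ⟪ v , u ⟫    ≡⟨ solve 3 (λ t p q → t :* p :+ t :* q := t :* (p :+ q))
                                              refl t ⟪ u , v ⟫ ⟪ v , u ⟫ ⟩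
        t * polar u v                    ∎

    module _ (0≤N : ∀ v → 0# ≤ N v) where

      ‖‖² : ∀ v → ‖ v ‖[ A ] ² ≡ N v
      ‖‖² v = √² (0≤N v)

      -- Nonnegativity of N at (s + t) v + (r + t) w; the shift by t > 0 makes the
      -- coefficients positive, and is then sent to 0.
      cauchy-schwarz : ∀ {r s} → 0# ≤ r → 0# ≤ s → ∀ v w → N v ≤ r ² → N w ≤ s ² →
        - polar v w ≤ ι 2 * (r * s)
      cauchy-schwarz {r} {s} 0≤r 0≤s v w Nv≤ Nw≤ = ≤-limit λ t 0<t t≤1 →
        let 0≤t = proj₁ 0<t in ≤-trans
          (*-cancelˡ-≤ (0<+ 0≤r 0<t) (*-cancelˡ-≤ (0<+ 0≤s 0<t) (≤-by
            (subst (0# ≤_) (N-combination (s + t) (r + t) v w) (0≤N ((s + t) *ᵥ v +ᵥ (r + t) *ᵥ w))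
              +≥0 0≤² (s + t) *≥0 (≤⇒0≤- Nv≤ +≥0 0≤t *≥0 (0≤ι 2 *≥0 0≤r +≥0 0≤t))
              +≥0 0≤² (r + t) *≥0 (≤⇒0≤- Nw≤ +≥0 0≤t *≥0 (0≤ι 2 *≥0 0≤s +≥0 0≤t)))
            (solve 6 (λ r s t p q B → let r′ = r :+ t ; s′ = s :+ t in
              s′ :* (r′ :* (con (ℤ.+ 2) :* (r′ :* s′))) :- s′ :* (r′ :* (:- B))
              := (s′ :* s′ :* p :+ s′ :* r′ :* B :+ r′ :* r′ :* q)
                 :+ s′ :* s′ :* (r :* r :- p :+ t :* (con (ℤ.+ 2) :* r :+ t))
                 :+ r′ :* r′ :* (s :* s :- q :+ t :* (con (ℤ.+ 2) :* s :+ t)))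
              refl r s t (N v) (N w) (polar v w)))))
          (≤-by (0≤ι 2 *≥0 (0≤t *≥0 ≤⇒0≤- t≤1))
            (solve 3 (λ r s t →
              con (ℤ.+ 2) :* (r :* s) :+ t :* (con (ℤ.+ 2) :* (r :+ s :+ con (ℤ.+ 1)))
                :- con (ℤ.+ 2) :* ((r :+ t) :* (s :+ t))
              := con (ℤ.+ 2) :* (t :* (con (ℤ.+ 1) :- t))) refl r s t))

-- Extracting finite values from extended real inequalities.

module ExtendedReals (𝓡 : CompleteOrderedField) where
  open ConvexOptimization 𝓡
  open FieldProperties 𝓡
  module ≤± = NonStrict _≤_

  private variable
    a b c d : ℝ
    e e₁ e₂ : ℝ ±

  ≤±-reflexive : e ≡ [ a ] → e ≤± [ a ]
  ≤±-reflexive refl = ≤±.[ ≤-refl ]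

  -- Serves to show that h is finite at a minimizer: +∞ on the left would have to lie below the
  -- right side, which is not +∞.
  finite : [ a ] +± e₁ ≤± [ b ] +± e₂ → e₁ ≢ ⊥± → e₂ ≢ ⊤± → ∃ λ c → e₁ ≡ [ c ]
  finite {e₁ = ⊥±}    h e₁≢⊥ e₂≢⊤ = ⊥-elim (e₁≢⊥ refl)
  finite {e₁ = [ c ]} h e₁≢⊥ e₂≢⊤ = c , refl
  finite {e₁ = ⊤±} {e₂ = ⊤±}    h e₁≢⊥ e₂≢⊤ = ⊥-elim (e₂≢⊤ refl)
  finite {e₁ = ⊤±} {e₂ = ⊥±}    () e₁≢⊥ e₂≢⊤
  finite {e₁ = ⊤±} {e₂ = [ _ ]} () e₁≢⊥ e₂≢⊤

  -- Serves to show that h is finite at an inexact minimizer: an infinite value would make the gap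
  -- +∞.
  finite-gap : ([ a ] +± e) -± [ b ] ≤± [ c ] → e ≢ ⊥± → ∃ λ d → e ≡ [ d ] × a + d - b ≤ c
  finite-gap {e = ⊥±}    h e≢⊥ = ⊥-elim (e≢⊥ refl)
  finite-gap {e = [ d ]} h e≢⊥ = d , refl , ≤±.[≤]-injective h
  finite-gap {e = ⊤±}    () e≢⊥

  +±-≤ : [ a ] +± [ b ] ≤± [ c ] +± e → e ≤± [ d ] → a + b ≤ c + d
  +±-≤ {e = ⊥±}    Supremum.[ () ]
  +±-≤ {c = c} {e = [ x ]} h e≤d = ≤-trans (≤±.[≤]-injective h)
    (+-mono-≤ {a = c} ≤-refl (≤±.[≤]-injective e≤d))
  +±-≤ {e = ⊤±}    h ()

-- The composite objective and its quadratic model.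

module ProximalStep (𝓡 : CompleteOrderedField) where
  open ConvexOptimization 𝓡
  open FieldProperties 𝓡
  open VectorProperties 𝓡
  open ExtendedReals 𝓡

  module Composite {n : ℕ} (A : Matrix n) (psd : PositiveSemidefinite A)
    (f : ℝ^ n → ℝ) (∇f : ℝ^ n → ℝ^ n) (h : ℝ^ n → ℝ ±) (μ : ℝ)
    (f-convex : Convex f) (f-smooth : Smooth ‖_‖[ A ] 1# f ∇f)
    (f-stronglyConvex : StronglyConvex ‖_‖[ A ] μ f ∇f)
    (h-proper : Proper h) (h-convex : Convex± h) where

    open QuadraticForm A

    0≤N : ∀ v → 0# ≤ N v
    0≤N = proj₂ psd

    Φ : ℝ^ n → ℝ ±
    Φ = composite f h

    model : ℝ^ n → ℝ^ n → ℝ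
    model = quadraticModel A f ∇f

    Φ̄ : ℝ^ n → ℝ^ n → ℝ ±
    Φ̄ x = composite (model x) h

    model≡ : ∀ x u → model x u ≡ f x + ∇f x · (u -ᵥ x) + ½ * N (u -ᵥ x)
    model≡ x u = cong (λ q → f x + ∇f x · (u -ᵥ x) + ½ * q) (‖‖² 0≤N (u -ᵥ x))

    -- The sign of μ is unrestricted, so convexity has to be combined with the
    -- quadratic lower bound on short segments.
    gradient-inequality : ∀ x y → f x + ∇f x · (y -ᵥ x) ≤ f y
    gradient-inequality x y = *-≤-limit λ t 0<t t≤1 →
      let q = (1# - t) *ᵥ x +ᵥ t *ᵥ y
          d = y -ᵥ x
          lower : f x + t * (∇f x · d) + μ / ι 2 * (t * t * N d) ≤ f q
          lower = subst (_≤ f q)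
            (cong₂ (λ g r → f x + g + μ / ι 2 * r)
              (trans (cong (∇f x ·_) (1-t+t t x y)) (·-*ʳ t (∇f x) d))
              (trans (‖‖² 0≤N (q -ᵥ x)) (trans (cong N (1-t+t t x y)) (N-* t d))))
            (f-stronglyConvex x q)
      in ≤-by (≤⇒0≤- (≤-trans lower (f-convex x y t (proj₁ 0<t) t≤1)))
        (solve 6 (λ t a b g r m →
          t :* (b :+ t :* (:- (m :* r))) :- t :* (a :+ g)
          := (con (ℤ.+ 1) :- t) :* a :+ t :* b :- (a :+ t :* g :+ m :* (t :* t :* r)))
          refl t (f x) (f y) (∇f x · d) (N d) (μ / ι 2))

    minimizer-finite : ∀ (F : ℝ^ n → ℝ) {p} → IsMinimizer (composite F h) p → ∃ λ H → h p ≡ [ H ]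
    minimizer-finite F {p} p-min = let (h≢⊥ , x₀ , hx₀≢⊤) = h-proper in
      finite (p-min x₀) (h≢⊥ p) hx₀≢⊤

    minimizer-≤ : ∀ (F : ℝ^ n → ℝ) {p u Hp Hu} → IsMinimizer (composite F h) p →
      h p ≡ [ Hp ] → h u ≤± [ Hu ] → F p + Hp ≤ F u + Hu
    minimizer-≤ F {p} {u} p-min hp≡ hu≤ =
      +±-≤ (subst (λ e → [ F p ] +± e ≤± composite F h u) hp≡ (p-min u)) hu≤

    -- Strong convexity of the model at its minimizer. Compare p with (1 - t)p + tu: the h-part is
    -- bounded by interpolation, and the quadratic part lies ½t(1 - t)N(u - p) below interpolation.
    -- Dividing by t and letting t tend to 0 leaves ½N(u - p).
    prox-inequality : ∀ {x p u Hp Hu} → IsMinimizer (Φ̄ x) p → h p ≡ [ Hp ] → h u ≤± [ Hu ] →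
      model x p + Hp + ½ * N (u -ᵥ p) ≤ model x u + Hu
    prox-inequality {x} {p} {u} {Hp} {Hu} p-min hp≡ hu≤ =
      subst₂ (λ mp mu → mp + Hp + ½ * N d ≤ mu + Hu) (sym (model≡ x p)) (sym model-u)
        (*-≤-limit λ t 0<t t≤1 → ≤-by
          (≤⇒0≤- (subst₂ (λ mp mq → mp + Hp ≤ mq + ((1# - t) * Hp + t * Hu))
            (model≡ x p) (model-q t)
            (minimizer-≤ (model x) p-min hp≡
              (h-convex p u Hp Hu t (proj₁ 0<t) t≤1 (≤±-reflexive hp≡) hu≤))))
          (solve 10 (λ t F g g′ r b r′ k Hp Hu →
            t :* (F :+ (g :+ g′) :+ k :* (r :+ b :+ r′) :+ Hu :+ t :* (k :* r′))
              :- t :* (F :+ g :+ k :* r :+ Hp :+ k :* r′)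
            := F :+ (g :+ t :* g′) :+ k :* (r :+ t :* b :+ t :* t :* r′)
                 :+ ((con (ℤ.+ 1) :- t) :* Hp :+ t :* Hu)
               :- (F :+ g :+ k :* r :+ Hp))
            refl t (f x) (∇f x · a) (∇f x · d) (N a) (polar a d) (N d) ½ Hp Hu))
      where
      a d : ℝ^ n
      a = p -ᵥ x
      d = u -ᵥ p

      model-u : model x u ≡ f x + (∇f x · a + ∇f x · d) + ½ * (N a + polar a d + N d)
      model-u = trans (model≡ x u) (cong₂ (λ g r → f x + g + ½ * r)
        (trans (cong (∇f x ·_) (sub-split p u x)) (·-+ʳ (∇f x) a d))
        (trans (cong N (sub-split p u x)) (N-+ a d)))

      model-q : ∀ t → model x ((1# - t) *ᵥ p +ᵥ t *ᵥ u)
        ≡ f x + (∇f x · a + t * (∇f x · d)) + ½ * (N a + t * polar a d + t * t * N d)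
      model-q t = trans (model≡ x _) (cong₂ (λ g r → f x + g + ½ * r)
        (trans (cong (∇f x ·_) (combination-sub t p u x))
          (trans (·-+ʳ (∇f x) a (t *ᵥ d)) (cong (∇f x · a +_) (·-*ʳ t (∇f x) d))))
        (trans (cong N (combination-sub t p u x)) (N-+-* t a d)))

    -- Inexact minimizers of the model.

    module Inexact {x p y Hp Hy ε} (p-min : IsMinimizer (Φ̄ x) p)
      (hp≡ : h p ≡ [ Hp ]) (hy≡ : h y ≡ [ Hy ])
      (gap : model x y + Hy - (model x p + Hp) ≤ ε) where

      prox-inequality-doubled : ∀ {u Hu} → h u ≤± [ Hu ] →
        ι 2 * (model x p + Hp) + N (u -ᵥ p) ≤ ι 2 * (model x u + Hu)
      prox-inequality-doubled {u} {Hu} hu≤ = subst (_≤ ι 2 * (model x u + Hu))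
        (2*[+½*] (model x p + Hp) (N (u -ᵥ p))) (2*-mono-≤ (prox-inequality p-min hp≡ hu≤))

      -- The model grows by at least ½N(y - p) from p to y, and this growth is at most the gap.
      N[y-p]≤2ε : N (y -ᵥ p) ≤ ι 2 * ε
      N[y-p]≤2ε = ≤-by
        (≤⇒0≤- (prox-inequality-doubled (≤±-reflexive hy≡))
          +≥0 0≤ι 2 *≥0 ≤⇒0≤- gap)
        (solve 4 (λ P Y r e → con (ℤ.+ 2) :* e :- r
          := con (ℤ.+ 2) :* Y :- (con (ℤ.+ 2) :* P :+ r) :+ con (ℤ.+ 2) :* (e :- (Y :- P)))
          refl (model x p + Hp) (model x y + Hy) (N (y -ᵥ p)) ε)

      -- Makes `√ (ι 2 * ε)` a genuine square root of 2ε.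
      0≤2ε : 0# ≤ ι 2 * ε
      0≤2ε = ≤-trans (0≤N (y -ᵥ p)) N[y-p]≤2ε

      -- Smoothness puts f below its model at y, the gap passes from y to p, `prox-inequality`
      -- passes from p to u, and the gradient inequality bounds the model at u by f(u) + ½N(u - x).
      descent : ∀ {u Hu} → h u ≤± [ Hu ] →
        ι 2 * (f y + Hy) + N (u -ᵥ p) ≤ ι 2 * (f u + Hu) + N (u -ᵥ x) + ι 2 * ε
      descent {u} {Hu} hu≤ = ≤-by
        (≤⇒0≤- (prox-inequality-doubled hu≤) +≥0 0≤ι 2 *≥0 ≤⇒0≤- gap
          +≥0 0≤ι 2 *≥0 ≤⇒0≤- (f-smooth x y) +≥0 ≤⇒0≤- model≤)
        (solve 11 (λ fy my Hy mp Hp fu mu Hu e rp rx → let 2× = con (ℤ.+ 2) :*_ in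
          2× (fu :+ Hu) :+ rx :+ 2× e :- (2× (fy :+ Hy) :+ rp)
          := (2× (mu :+ Hu) :- (2× (mp :+ Hp) :+ rp)) :+ 2× (e :- (my :+ Hy :- (mp :+ Hp)))
             :+ 2× (my :- fy) :+ (2× fu :+ rx :- 2× mu))
          refl (f y) (model x y) Hy (model x p) Hp (f u) (model x u) Hu ε
          (N (u -ᵥ p)) (N (u -ᵥ x)))
        where
        model≤ : ι 2 * model x u ≤ ι 2 * f u + N (u -ᵥ x)
        model≤ = subst₂ _≤_ (cong (ι 2 *_) (sym (model≡ x u))) (2*[+½*] (f u) (N (u -ᵥ x)))
          (2*-mono-≤ (+-monoˡ-≤ (½ * N (u -ᵥ x)) (gradient-inequality x u)))

      -- This is `descent` at u = (1 - τ)y′ + τw, with Φ(u) bounded by convexity and u - p expanded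
      -- about y, since it is u - y that equals -τ(z₊ - w).
      inexact-energy : ∀ {τ α y′ z z₊ w Hy′ Hw} → 0# ≤ τ → τ ≤ 1# → τ * α ≡ 1# →
        x ≡ (1# - τ) *ᵥ y′ +ᵥ τ *ᵥ z → z₊ ≡ z +ᵥ α *ᵥ (y -ᵥ x) →
        h y′ ≡ [ Hy′ ] → h w ≡ [ Hw ] →
        ι 2 * (f y + Hy - (f w + Hw)) + τ * τ * N (z₊ -ᵥ w)
          ≤ ι 2 * ((1# - τ) * (f y′ + Hy′ - (f w + Hw))) + τ * τ * N (z -ᵥ w)
            + ι 2 * (√ (ι 2 * ε) * (τ * ‖ z₊ -ᵥ w ‖[ A ])) + ι 2 * ε
      inexact-energy {τ} {α} {y′} {z} {_} {w} {Hy′} {Hw} 0≤τ τ≤1 τα≡1 refl refl hy′≡ hw≡ = ≤-by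
        (≤⇒0≤- (subst₂ (λ p q → ι 2 * (f y + Hy) + p ≤ ι 2 * (f u + Hu) + q + ι 2 * ε)
            (trans (cong N (sub-split y u p)) (trans (N-+ (y -ᵥ p) (u -ᵥ y))
              (cong (N (y -ᵥ p) + polar (y -ᵥ p) (u -ᵥ y) +_) N[u-y])))
            (trans (cong N (combination-sub-combination τ y′ z w)) (N-* (- τ) (z -ᵥ w)))
            (descent (h-convex y′ w Hy′ Hw τ 0≤τ τ≤1 (≤±-reflexive hy′≡) (≤±-reflexive hw≡))))
          +≥0 0≤ι 2 *≥0 ≤⇒0≤- (f-convex y′ w τ 0≤τ τ≤1)
          -- The cross term of N((y - p) + (u - y)) is at least -2 √(2ε) τ‖z₊ - w‖, because N(y - p)
          -- ≤ 2ε; the remaining N(y - p) is nonnegative and is dropped.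
          +≥0 ≤⇒0≤- (cauchy-schwarz 0≤N (0≤√ _) (0≤τ *≥0 0≤√ _) (y -ᵥ p) (u -ᵥ y)
                (subst (N (y -ᵥ p) ≤_) (sym (√² 0≤2ε)) N[y-p]≤2ε) (≤-reflexive N[u-y]′))
          +≥0 0≤N (y -ᵥ p))
        (solve 14 (λ t e fy Hy fy′ Hy′ fw Hw fu Z Z′ B Np sR →
          let 2×   = con (ℤ.+ 2) :*_
              t′   = con (ℤ.+ 1) :- t
              Hu   = t′ :* Hy′ :+ t :* Hw in
          2× (t′ :* (fy′ :+ Hy′ :- (fw :+ Hw))) :+ t :* t :* Z :+ 2× sR :+ 2× e
            :- (2× (fy :+ Hy :- (fw :+ Hw)) :+ t :* t :* Z′)
          := (2× (fu :+ Hu) :+ (:- t) :* (:- t) :* Z :+ 2× e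
               :- (2× (fy :+ Hy) :+ (Np :+ B :+ (:- t) :* (:- t) :* Z′)))
             :+ 2× (t′ :* fy′ :+ t :* fw :- fu) :+ (2× sR :- (:- B)) :+ Np)
          refl τ ε (f y) Hy (f y′) Hy′ (f w) Hw (f u) (N (z -ᵥ w)) (N (z₊ -ᵥ w))
          (polar (y -ᵥ p) (u -ᵥ y)) (N (y -ᵥ p)) (√ (ι 2 * ε) * (τ * ‖ z₊ -ᵥ w ‖[ A ])))
        where
        u z₊ : ℝ^ n
        u  = (1# - τ) *ᵥ y′ +ᵥ τ *ᵥ w
        z₊ = z +ᵥ α *ᵥ (y -ᵥ x)

        Hu : ℝ
        Hu = (1# - τ) * Hy′ + τ * Hw

        N[u-y] : N (u -ᵥ y) ≡ (- τ) * (- τ) * N (z₊ -ᵥ w)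
        N[u-y] = trans (cong N (combination-sub-step τα≡1 y′ z w y)) (N-* (- τ) (z₊ -ᵥ w))

        N[u-y]′ : N (u -ᵥ y) ≡ (τ * ‖ z₊ -ᵥ w ‖[ A ]) ²
        N[u-y]′ = begin
          N (u -ᵥ y)                             ≡⟨ N[u-y] ⟩
          (- τ) * (- τ) * N (z₊ -ᵥ w)            ≡⟨ cong ((- τ) * (- τ) *_) (‖‖² 0≤N (z₊ -ᵥ w)) ⟨
          (- τ) * (- τ) * ‖ z₊ -ᵥ w ‖[ A ] ²     ≡⟨ solve 2 (λ t r → (:- t) :* (:- t) :* (r :* r)
                                                      := t :* r :* (t :* r)) refl τ ‖ z₊ -ᵥ w ‖[ A ] ⟩
          (τ * ‖ z₊ -ᵥ w ‖[ A ]) ²               ∎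
          where open ≡-Reasoning

    -- The accelerated iteration and induction on the energy.

    module Run (x* : ℝ^ n) (x*-min : IsMinimizer Φ x*) (prox-exists : ∀ x → HasMinimizer (Φ̄ x))
      {T : ℕ} {ε : ℕ → ℝ} {x y z : ℕ → ℝ^ n} (run : AcceleratedRun Φ̄ prox-exists T ε x y z) where

      open AcceleratedRun run

      H* φ* : ℝ
      H* = proj₁ (minimizer-finite f x*-min)
      φ* = f x* + H*

      hx*≡ : h x* ≡ [ H* ]
      hx*≡ = proj₂ (minimizer-finite f x*-min)

      s : ℕ → ℝ
      s k = √ (ι 2 * ε k)

      B : ℕ → ℝ
      B k = ‖ x 0 -ᵥ x* ‖[ A ] + ι 3 * ∑[1⋯ k ] (λ k → ι k * s k)

      0≤B : ∀ k → 0# ≤ B k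
      0≤B k = 0≤√ _ +≥0 0≤ι 3 *≥0 0≤∑ k
        where
        0≤∑ : ∀ k → 0# ≤ ∑[1⋯ k ] (λ k → ι k * s k)
        0≤∑ zero    = ≤-refl
        0≤∑ (suc k) = 0≤∑ k +≥0 0≤ι (suc k) *≥0 0≤√ _

      -- The inequality 4 Eₖ ≤ 4 Bₖ², paired with finiteness of h. The point is a parameter instead
      -- of `y k`, so that x* can stand in for y⁽⁰⁾ at the start.
      EnergyBound : ℕ → ℝ^ n → ℝ → Set
      EnergyBound k y H = h y ≡ [ H ] ×
        ι 2 * (ι (suc k) ² * (f y + H - φ*)) + ι 4 * N (z k -ᵥ x*) ≤ ι 4 * B k ²

      0<α : ∀ k → 0# < α₊₁ k
      0<α k = 0</ (subst (λ m → 0# < ι m) (ℕ.+-comm 2 k) (0<ι (suc k))) (0<ι 1)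

      τα≡1 : ∀ k → τ k * α₊₁ k ≡ 1#
      τα≡1 k = /-* (0<α k)

      0≤τ : ∀ k → 0# ≤ τ k
      0≤τ k = proj₁ (0</ (1≤⇒0< ≤-refl) (0<α k))

      -- Written with `2 ℕ.+ k`, which `ι` unfolds, in place of the `k ℕ.+ 2` of `α₊₁`, on which it
      -- is stuck.
      ι[2+k]τ≡2 : ∀ k → ι (2 ℕ.+ k) * τ k ≡ ι 2
      ι[2+k]τ≡2 k = begin
        ι (2 ℕ.+ k) * τ k       ≡⟨ cong (λ m → ι m * τ k) (ℕ.+-comm 2 k) ⟩
        ι (k ℕ.+ 2) * τ k       ≡⟨ cong (_* τ k) (/-* (0<ι 1)) ⟨
        α₊₁ k * ι 2 * τ k       ≡⟨ solve 2 (λ a t → a :* con (ℤ.+ 2) :* t := t :* a :* con (ℤ.+ 2))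
                                     refl (α₊₁ k) (τ k) ⟩
        τ k * α₊₁ k * ι 2       ≡⟨ cong (_* ι 2) (τα≡1 k) ⟩
        1# * ι 2                ≡⟨ *-identityˡ (ι 2) ⟩
        ι 2                     ∎
        where open ≡-Reasoning

      τ≤1 : ∀ k → τ k ≤ 1#
      τ≤1 k = *-cancelˡ-≤ (0<ι (suc k)) (subst (_≤ ι (2 ℕ.+ k) * 1#) (sym (ι[2+k]τ≡2 k))
        (≤-by (0≤ι k) (solve 1 (λ k →
          (k :+ con (ℤ.+ 1) :+ con (ℤ.+ 1)) :* con (ℤ.+ 1) :- con (ℤ.+ 2) := k) refl (ι k))))

      τ₀≡1 : τ 0 ≡ 1#
      τ₀≡1 = antisym (τ≤1 0) (*-cancelˡ-≤ (0<ι 1)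
        (≤-reflexive (trans (*-identityʳ (ι 2)) (sym (ι[2+k]τ≡2 0)))))

      energy-step : ∀ k → k ℕ.< T → ∀ {y′ H′} → EnergyBound k y′ H′ →
        x (suc k) ≡ (1# - τ k) *ᵥ y′ +ᵥ τ k *ᵥ z k → ∃ (EnergyBound (suc k) (y (suc k)))
      energy-step k k<T {y′} {H′} (hy′≡ , bound) x≡
        -- Abstracting the minimizer together with the gap lets `minimum` reduce to the value at p.
        with prox-exists (x (suc k)) | y-step k k<T
      ... | p , p-min | y-gap
        with minimizer-finite (model (x (suc k))) p-min
      ... | Hp , hp≡
        with finite-gap
          (subst (λ e → Φ̄ (x (suc k)) (y (suc k)) -± ([ model (x (suc k)) p ] +± e) ≤± [ ε (suc k) ])
            hp≡ y-gap) (proj₁ h-proper (y (suc k)))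
      ... | Hy , hy≡ , gap = Hy , hy≡ ,
        subst (ι 2 * (m ² * D′) + ι 4 * Z′ ≤_) (cong (λ b → ι 4 * b ²) B+≡)
          (growth (0≤ι (suc k) *≥0 0≤s) (0≤B k) 4R²≤
            (≤-by (≤⇒0≤- rescaled +≥0 ≤⇒0≤- bound)
              (solve 5 (λ w b e r q → b :+ r :+ q :- w := (e :+ r :+ q :- w) :+ (b :- e)) refl
                (ι 2 * (m ² * D′) + ι 4 * Z′) (ι 4 * B k ²) (ι 2 * (j ² * D) + ι 4 * Z) (ι 8 * (j * s (suc k) * R))
                (ι 4 * (j * s (suc k)) ²))))
        where
        open Inexact p-min hp≡ hy≡ gap

        j m D D′ Z Z′ R : ℝ
        j  = ι (suc k)
        m  = ι (2 ℕ.+ k)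
        D  = f y′ + H′ - φ*
        D′ = f (y (suc k)) + Hy - φ*
        Z  = N (z k -ᵥ x*)
        Z′ = N (z (suc k) -ᵥ x*)
        R  = ‖ z (suc k) -ᵥ x* ‖[ A ]

        0≤s : 0# ≤ s (suc k)
        0≤s = 0≤√ _

        0≤gap : ∀ {u H} → h u ≡ [ H ] → 0# ≤ f u + H - φ*
        0≤gap hu≡ = ≤⇒0≤- (minimizer-≤ f x*-min hx*≡ (≤±-reflexive hu≡))

        rescaled : ι 2 * (m ² * D′) + ι 4 * Z′
          ≤ ι 2 * (j ² * D) + ι 4 * Z + ι 8 * (j * s (suc k) * R) + ι 4 * (j * s (suc k)) ²
        -- Since m = j + 1, the two numerical conditions are j² + 2m - m² = 1 ≥ 0 and 2j - m = k ≥
        -- 0.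
        rescaled = energy-rescaled (ι[2+k]τ≡2 k) (0≤ι (2 ℕ.+ k))
          (≤-by 0≤1 (solve 1 (λ j → j :* j :+ con (ℤ.+ 2) :* (j :+ con (ℤ.+ 1))
            :- (j :+ con (ℤ.+ 1)) :* (j :+ con (ℤ.+ 1)) := con (ℤ.+ 1)) refl j))
          (≤-by (0≤ι k) (solve 1 (λ i → let j = i :+ con (ℤ.+ 1) in
            con (ℤ.+ 2) :* j :- (j :+ con (ℤ.+ 1)) := i) refl (ι k)))
          (0≤gap hy′≡) 0≤s (0≤√ _)
          (subst (λ e → ι 2 * D′ + τ k * τ k * Z′
              ≤ ι 2 * ((1# - τ k) * D) + τ k * τ k * Z + ι 2 * (s (suc k) * (τ k * R)) + e)
            (sym (√² 0≤2ε))
            (inexact-energy (0≤τ k) (τ≤1 k) (τα≡1 k) x≡ (z-step k k<T) hy′≡ hx*≡))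

        4R²≤ : ι 4 * R ² ≤ ι 2 * (m ² * D′) + ι 4 * Z′
        4R²≤ = ≤-by (0≤ι 2 *≥0 (0≤² m *≥0 0≤gap hy≡)) (trans
          (cong (λ r → ι 2 * (m ² * D′) + ι 4 * Z′ - ι 4 * r) (‖‖² 0≤N (z (suc k) -ᵥ x*)))
          (solve 2 (λ d r → d :+ r :- r := d) refl (ι 2 * (m ² * D′)) (ι 4 * Z′)))

        B+≡ : B k + ι 3 * (j * s (suc k)) ≡ B (suc k)
        B+≡ = solve 3 (λ r a b → r :+ con (ℤ.+ 3) :* a :+ con (ℤ.+ 3) :* b
          := r :+ con (ℤ.+ 3) :* (a :+ b)) refl ‖ x 0 -ᵥ x* ‖[ A ]
          (∑[1⋯ k ] (λ k → ι k * s k)) (j * s (suc k))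

      -- The first step uses y⁽⁰⁾ with weight 1 − τ₀ = 0, so y⁽⁰⁾, at which h may be
      -- infinite, can be replaced by x*.
      energy-start : EnergyBound 0 x* H*
      energy-start = hx*≡ , ≤-reflexive (begin
        ι 2 * (ι 1 ² * (φ* - φ*)) + ι 4 * N (z 0 -ᵥ x*)
          ≡⟨ solve 3 (λ i p r → con (ℤ.+ 2) :* (i :* i :* (p :- p)) :+ con (ℤ.+ 4) :* r
               := con (ℤ.+ 4) :* r) refl (ι 1) φ* (N (z 0 -ᵥ x*)) ⟩
        ι 4 * N (z 0 -ᵥ x*)
          ≡⟨ cong (λ v → ι 4 * N (v -ᵥ x*)) z-init ⟩
        ι 4 * N (x 0 -ᵥ x*)
          ≡⟨ cong (ι 4 *_) (‖‖² 0≤N (x 0 -ᵥ x*)) ⟨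
        ι 4 * ‖ x 0 -ᵥ x* ‖[ A ] ²
          ≡⟨ solve 1 (λ r → con (ℤ.+ 4) :* (r :* r)
               := con (ℤ.+ 4) :* ((r :+ con (ℤ.+ 3) :* con +0) :* (r :+ con (ℤ.+ 3) :* con +0)))
               refl ‖ x 0 -ᵥ x* ‖[ A ] ⟩
        ι 4 * B 0 ² ∎)
        where open ≡-Reasoning

      x₁≡ : 0 ℕ.< T → x 1 ≡ (1# - τ 0) *ᵥ x* +ᵥ τ 0 *ᵥ z 0
      x₁≡ 0<T = trans (x-step 0 0<T) (cong (_+ᵥ τ 0 *ᵥ z 0)
        (subst (λ c → c *ᵥ y 0 ≡ c *ᵥ x*) (sym 1-τ₀≡0) (0*ᵥ (y 0) x*)))
        where
        1-τ₀≡0 : 1# - τ 0 ≡ 0#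
        1-τ₀≡0 = trans (cong (λ t → 1# - t) τ₀≡1) (-‿inverseʳ 1#)

      -- Indexed from y⁽¹⁾ on, where the gap of the preceding proximal step guarantees that h is
      -- finite.
      energy-bound : ∀ k → k ℕ.< T → ∃ (EnergyBound (suc k) (y (suc k)))
      energy-bound zero    0<T = energy-step 0 0<T energy-start (x₁≡ 0<T)
      energy-bound (suc k) k<T with energy-bound k (ℕ.<-trans (ℕ.n<1+n k) k<T)
      ... | H , bound = energy-step (suc k) k<T bound (x-step (suc k) k<T)

      -- Drop the nonnegative term 4N(z⁽ᵏ⁺¹⁾ - x*) from the energy and divide by 2(k + 2)²; for T =
      -- k + 1 the denominator is (T + 1)².
      rate : ∀ k → k ℕ.< T → ∃ λ H → h (y (suc k)) ≡ [ H ] ×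
        f (y (suc k)) + H - φ* ≤ ι 2 / ι (2 ℕ.+ k) ² * B (suc k) ²
      rate k k<T with energy-bound k k<T
      ... | H , hy≡ , bound = H , hy≡ , *-cancelˡ-≤ 0<M² (*-cancelˡ-≤ (0<ι 1) (≤-by
        (≤⇒0≤- bound +≥0 0≤ι 4 *≥0 0≤N (z (suc k) -ᵥ x*))
        (begin
          ι 2 * (M² * (ι 2 / M² * B²)) - ι 2 * (M² * D)
            ≡⟨ solve 4 (λ m q b d → con (ℤ.+ 2) :* (m :* (q :* b)) :- con (ℤ.+ 2) :* (m :* d)
                 := con (ℤ.+ 2) :* (q :* m :* b) :- con (ℤ.+ 2) :* (m :* d)) refl M² (ι 2 / M²) B² D ⟩
          ι 2 * (ι 2 / M² * M² * B²) - ι 2 * (M² * D)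
            ≡⟨ cong (λ q → ι 2 * (q * B²) - ι 2 * (M² * D)) (/-* 0<M²) ⟩
          ι 2 * (ι 2 * B²) - ι 2 * (M² * D)
            ≡⟨ solve 4 (λ m b d r → con (ℤ.+ 2) :* (con (ℤ.+ 2) :* b) :- con (ℤ.+ 2) :* (m :* d)
                 := con (ℤ.+ 4) :* b :- (con (ℤ.+ 2) :* (m :* d) :+ con (ℤ.+ 4) :* r)
                    :+ con (ℤ.+ 4) :* r) refl M² B² D (N (z (suc k) -ᵥ x*)) ⟩
          ι 4 * B² - (ι 2 * (M² * D) + ι 4 * N (z (suc k) -ᵥ x*)) + ι 4 * N (z (suc k) -ᵥ x*) ∎)))
        where
        open ≡-Reasoning

        M² B² D : ℝ
        M² = ι (2 ℕ.+ k) ²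
        B² = B (suc k) ²
        D  = f (y (suc k)) + H - φ*

        0<M² : 0# < M²
        0<M² = 1≤⇒0< (≤-trans 1≤m (≤-by (0≤m *≥0 ≤⇒0≤- 1≤m)
          (solve 1 (λ m → m :* m :- m := m :* (m :- con (ℤ.+ 1))) refl (ι (2 ℕ.+ k)))))
          where
          1≤m = 1≤ι (suc k)
          0≤m = 0≤ι (2 ℕ.+ k)

theorem8p3 :
    (𝓡 : CompleteOrderedField) → let open ConvexOptimization 𝓡 in
    (n : ℕ) (A : Matrix n) → PositiveSemidefinite A →
    (f : ℝ^ n → ℝ) (∇f : ℝ^ n → ℝ^ n) (h : ℝ^ n → ℝ ±) (μ : ℝ) →
    Convex f → IsGradient f ∇f →
    Smooth ‖_‖[ A ] 1# f ∇f → StronglyConvex ‖_‖[ A ] μ f ∇f →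
    LowerSemicontinuous h → Proper h → Convex± h →
    let Φ   = composite f h
        Φ̄ x = composite (quadraticModel A f ∇f x) h in
    (x* : ℝ^ n) → IsMinimizer Φ x* →
    (prox-exists : ∀ x → HasMinimizer (Φ̄ x)) →
    (T : ℕ) (ε : ℕ → ℝ) (x y z : ℕ → ℝ^ n) →
    AcceleratedRun Φ̄ prox-exists T ε x y z →
    1 ℕ.< T →
    Φ (y T) -± Φ x* ≤±
      [ ι 2 / (ι (suc T)) ²
        * (‖ x 0 -ᵥ x* ‖[ A ] + ι 3 * ∑[1⋯ T ] (λ k → ι k * √ (ι 2 * ε k))) ² ]
theorem8p3 𝓡 n A psd f ∇f h μ f-convex f-gradient f-smooth f-stronglyConvex h-lsc h-proper h-convex
  x* x*-min prox-exists (suc k) ε x y z run 1<T =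
  let (H , hy≡ , bound) = rate k (ℕ.n<1+n k) in
  -- With h replaced by its finite values at both points, the extended difference computes to a real
  -- one.
  subst₂ (λ e e* → ([ f (y (suc k)) ] +± e) -± ([ f x* ] +± e*) ≤± _) (sym hy≡) (sym hx*≡)
    ≤±.[ bound ]
  where
  open ConvexOptimization 𝓡
  open ExtendedReals 𝓡
  open ProximalStep.Composite 𝓡 A psd f ∇f h μ f-convex f-smooth f-stronglyConvex h-proper h-convex
  open Run x* x*-min prox-exists run
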